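{- Let $E$ be a finite set of items, let $O$ be a set of states, and let $\mathbb{P}[\Phi]$ be a (known) probability distribution over realizations $\Phi : E \to O$. Let $f : 2^E \times O^E \to \mathbb{R}_{\geq 0}$ be adaptive monotone and adaptive submodular with respect to $\mathbb{P}[\Phi]$. Let $p$ be a positive integer, let $(E,\mathcal{I})$ be a $p$-independence system, and let $\alpha \in [0,1]$. Let $\pi$ be a policy which is $\alpha$-approximate greedy with respect to $f$ for constraint $\mathcal{I}$. Then $$f_{\text{avg}}(\pi) \;\geq\; \left(\frac{\alpha}{p+\alpha}\right) \max_{\text{feasible } \pi^*} f_{\text{avg}}(\pi^*),$$ where a policy $\pi^*$ is feasible iff $E(\pi^*,\Phi) \in \mathcal{I}$ for all realizations $\Phi$; that is, $f_{\text{avg}}(\pi) \geq \frac{\alpha}{p+\alpha} f_{\text{avg}}(\pi^*)$ for every feasible policy $\pi^*$.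
   Context: **$p$-independence system.** A pair $(E,\mathcal{I})$ with $\mathcal{I} \subseteq 2^E$ nonempty (members are called independent sets) such that: (i) for all $A \subset B \subseteq E$, if $B \in \mathcal{I}$ then $A \in \mathcal{I}$; (ii) for $C \subseteq E$ let $\mathcal{B}(C) := \{B \subseteq C : B \in \mathcal{I} \text{ and } B \cup \{e\} \notin \mathcal{I} \text{ for all } e \in C \setminus B\}$ be the set of maximal independent subsets of $C$; then for all nonempty $C \subseteq E$, $\max_{B \in \mathcal{B}(C)} |B| \leq p \cdot \min_{B \in \mathcal{B}(C)} |B|$. **Realizations.** A realization is a function $\Phi : E \to O$ giving the state of each item. The distribution $\mathbb{P}[\Phi]$ is discrete (given by a probability mass function on $O^E$), and all expectations below are assumed to exist and be finite. A partial realization $\Psi$ is a function from a subset $\mathrm{dom}(\Psi) \subseteq E$ to $O$, identified with its graph $\{(e,o) : \Psi(e)=o\} \subseteq E \times O$. Write $\Phi \sim \Psi$ ($\Psi$ is consistent with $\Phi$) if $\Phi$ and $\Psi$ agree on $\mathrm{dom}(\Psi)$, and $\mathbb{P}[\Psi] := \mathbb{P}[\Phi \sim \Psi]$. $\Psi$ is a subrealization of $\Psi'$ iff $\Psi \subseteq \Psi'$. **Policies.** A (deterministic) policy $\pi$ is a function from a set $\mathrm{dom}(\pi)$ of partial realizations to $E$, where $\mathrm{dom}(\pi)$ is closed under subrealizations. Under realization $\Phi$ it runs as follows: start with $\Psi = \emptyset$; while $\Psi \in \mathrm{dom}(\pi)$, select item $e = \pi(\Psi)$, observe $\Phi(e)$,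 and replace $\Psi$ by $\Psi \cup \{(e,\Phi(e))\}$; terminate when $\Psi \notin \mathrm{dom}(\pi)$. $E(\pi,\Phi)$ denotes the set of items selected by $\pi$ under $\Phi$. The expected utility is $f_{\text{avg}}(\pi) := \mathbb{E}[f(E(\pi,\Phi),\Phi)]$, the expectation being with respect to $\mathbb{P}[\Phi]$. **Conditional expected marginal benefit.** For a partial realization $\Psi$ with $\mathbb{P}[\Psi]>0$ and $e \in E$, $\Delta(e \mid \Psi) := \mathbb{E}\left[f(\mathrm{dom}(\Psi) \cup \{e\},\Phi) - f(\mathrm{dom}(\Psi),\Phi) \mid \Phi \sim \Psi\right]$. **Adaptive monotone** (w.r.t. $\mathbb{P}[\Phi]$): $\Delta(e \mid \Psi) \geq 0$ for all $\Psi$ with $\mathbb{P}[\Psi]>0$ and all $e \in E$. **Adaptive submodular** (w.r.t. $\mathbb{P}[\Phi]$): $\Delta(e \mid \Psi') \leq \Delta(e \mid \Psi)$ for all $\Psi \subseteq \Psi'$ (with $\mathbb{P}[\Psi'] > 0$) and all $e \in E$. **$\alpha$-approximate greedy policy for constraint $\mathcal{I}$.** A policy $\pi$ such that, upon observing a partial realization $\Psi$ (with $\mathbb{P}[\Psi]>0$): if there is an item $e \in E \setminus \mathrm{dom}(\Psi)$ with $\mathrm{dom}(\Psi) \cup \{e\} \in \mathcal{I}$, then $\pi$ selects such an item $e$ satisfying $\Delta(e \mid \Psi) \geq \alpha \cdot \max_{e' : \mathrm{dom}(\Psi) \cup \{e'\} \in \mathcal{I}} \Delta(e' \mid \Psi)$;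 if no such item exists, $\pi$ terminates. -}

module Defs where

open import Algebra.Bundles using (CommutativeRing)
open import Axiom.ExcludedMiddle using (ExcludedMiddle)
open import Data.Bool.Base using (if_then_else_)
open import Data.Fin.Base using (Fin)
open import Data.Fin.Subset using (Subset; _∈_; _∉_; _⊆_; _∪_; ⁅_⁆; ∣_∣; Nonempty)
open import Data.List.Base using (List; foldr; map)
import Data.List.Relation.Binary.Subset.Propositional as List
open import Data.List.Relation.Unary.Unique.Propositional using (Unique)
open import Data.Maybe.Base using (Maybe; just; nothing; maybe′; is-just)
open import Data.Maybe using (Is-just)
import Data.Nat.Base as ℕ
open import Data.Nat.Base using (ℕ; zero; suc)
open import Data.Product.Base using (∃; _×_; _,_)
open import Data.Vec.Base as Vec using (Vec; lookup; replicate; _[_]≔_)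
open import Level using (0ℓ) renaming (suc to lsuc)
open import Relation.Binary.Core using (Rel)
open import Relation.Binary.PropositionalEquality.Core using (_≡_)
open import Relation.Binary.Structures using (IsTotalOrder)
open import Relation.Nullary.Decidable.Core using (Dec; yes; no; does)
open import Relation.Nullary.Negation.Core using (¬_)
open import Relation.Unary using (Pred)

IsMaximum : {A : Set} → Rel A 0ℓ → Pred A 0ℓ → Pred A 0ℓ
IsMaximum _≤_ P m = P m × (∀ x → P x → x ≤ m)

IsMinimum : {A : Set} → Rel A 0ℓ → Pred A 0ℓ → Pred A 0ℓ
IsMinimum _≤_ P m = P m × (∀ x → P x → m ≤ x)

------------------------------------------------------------------------
-- Real numbers

-- The real numbers are, up to isomorphism, the only Dedekind-complete
-- ordered field; results about ℝ are stated for an arbitrary one.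

record CompleteOrderedField : Set (lsuc 0ℓ) where
  infix  4 _≤_
  infix  8 _⁻¹
  infixl 7 _/_

  field
    commutativeRing : CommutativeRing 0ℓ 0ℓ

  open CommutativeRing commutativeRing public

  field
    0≉1          : ¬ (0# ≈ 1#)
    _⁻¹          : Carrier → Carrier    -- unconstrained at 0#
    ⁻¹-cong      : ∀ {x y} → x ≈ y → x ⁻¹ ≈ y ⁻¹
    ⁻¹-inverseʳ  : ∀ x → ¬ (x ≈ 0#) → x * x ⁻¹ ≈ 1#
    _≤_          : Rel Carrier 0ℓ
    isTotalOrder : IsTotalOrder _≈_ _≤_
    +-monoˡ-≤    : ∀ z {x y} → x ≤ y → x + z ≤ y + z
    *-nonneg     : ∀ {x y} → 0# ≤ x → 0# ≤ y → 0# ≤ x * y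

  UpperBound : Pred Carrier 0ℓ → Pred Carrier 0ℓ
  UpperBound P u = ∀ x → P x → x ≤ u

  field
    complete : (P : Pred Carrier 0ℓ) → ∃ P → ∃ (UpperBound P) →
               ∃ λ s → UpperBound P s × (∀ u → UpperBound P u → s ≤ u)

  open import Relation.Binary.Construct.NonStrictToStrict _≈_ _≤_ public
    using (_<_)

  open import Algebra.Properties.Semiring.Mult semiring using () renaming (_×_ to _·_)

  fromℕ : ℕ → Carrier
  fromℕ k = k · 1#

  _/_ : Carrier → Carrier → Carrier
  x / y = x * y ⁻¹

------------------------------------------------------------------------
-- Independence systems on the ground set Fin n

module _ {n : ℕ} where

  MaximalIndependent : Pred (Subset n) 0ℓ → Subset n → Pred (Subset n) 0ℓ
  MaximalIndependent ℐ C B =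
    B ⊆ C × ℐ B × (∀ e → e ∈ C → e ∉ B → ¬ ℐ (B ∪ ⁅ e ⁆))

  MaximalSize : Pred (Subset n) 0ℓ → Subset n → Pred ℕ 0ℓ
  MaximalSize ℐ C k = ∃ λ B → MaximalIndependent ℐ C B × k ≡ ∣ B ∣

  record IsIndependenceSystem (p : ℕ) (ℐ : Pred (Subset n) 0ℓ) : Set where
    field
      nonempty   : ∃ ℐ
      hereditary : ∀ {A B} → A ⊆ B → ℐ B → ℐ A
      ratio      : ∀ C → Nonempty C → ∀ {M m} →
                   IsMaximum ℕ._≤_ (MaximalSize ℐ C) M →
                   IsMinimum ℕ._≤_ (MaximalSize ℐ C) m →
                   M ℕ.≤ p ℕ.* m

------------------------------------------------------------------------
-- Sums over arbitrary index sets

module Summation (em : ExcludedMiddle 0ℓ) (ℝ : CompleteOrderedField) where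

  open CompleteOrderedField ℝ

  module _ {I : Set} where

    finiteSum : (I → Carrier) → List I → Carrier
    finiteSum g F = foldr _+_ 0# (map g F)

    -- Unconditional convergence: the net of sums over finite subsets of I
    -- (lists without repetitions) tends to s.
    HasSum : (I → Carrier) → Pred Carrier 0ℓ
    HasSum g s = ∀ ε → 0# < ε → ∃ λ F₀ → ∀ F → Unique F → F₀ List.⊆ F →
                 s - ε < finiteSum g F × finiteSum g F < s + ε

    Summable : Pred (I → Carrier) 0ℓ
    Summable g = ∃ (HasSum g)

    -- Total by convention: 0# for families that are not summable.
    ∑ : (I → Carrier) → Carrier
    ∑ g = value em
      where
      value : Dec (Summable g) → Carrier
      value (yes (s , _)) = s
      value (no _)        = 0#

------------------------------------------------------------------------
-- Adaptive optimisation with items Fin n and states O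

module Adaptive (em : ExcludedMiddle 0ℓ) (ℝ : CompleteOrderedField)
                (n : ℕ) (O : Set) where

  open CompleteOrderedField ℝ
  open Summation em ℝ

  infix 4 _∼_ _⊑_

  Item : Set
  Item = Fin n

  Realization : Set
  Realization = Vec O n

  PartialRealization : Set
  PartialRealization = Vec (Maybe O) n

  dom : PartialRealization → Subset n
  dom = Vec.map is-just

  _∼_ : Realization → PartialRealization → Set
  Φ ∼ Ψ = ∀ e o → lookup Ψ e ≡ just o → lookup Φ e ≡ o

  _⊑_ : Rel PartialRealization 0ℓ
  Ψ ⊑ Ψ′ = ∀ e o → lookup Ψ e ≡ just o → lookup Ψ′ e ≡ just o

  Utility : Set
  Utility = Subset n → Realization → Carrier

  -- The policy's domain consists of those Ψ at which select is a just.
  record Policy : Set where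
    field
      select : PartialRealization → Maybe Item
      closed : ∀ {Ψ Ψ′} → Ψ ⊑ Ψ′ → Is-just (select Ψ′) → Is-just (select Ψ)

  open Policy public

  step : Policy → Realization → PartialRealization → PartialRealization
  step π Φ Ψ = maybe′ (λ e → Ψ [ e ]≔ just (lookup Φ e)) Ψ (select π Ψ)

  run : Policy → Realization → ℕ → PartialRealization
  run π Φ zero    = replicate n nothing
  run π Φ (suc k) = step π Φ (run π Φ k)

  -- A step either enlarges the domain or leaves the partial realization
  -- fixed for ever (termination, or selecting an observed item again), so
  -- all items that are ever selected are selected within the first n steps.
  selected : Policy → Realization → Subset n
  selected π Φ = dom (run π Φ n)

  Observes : Policy → PartialRealization → Set
  Observes π Ψ = ∃ λ Φ → ∃ λ k → run π Φ k ≡ Ψ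

  Feasible : Pred (Subset n) 0ℓ → Pred Policy 0ℓ
  Feasible ℐ π = ∀ Φ → ℐ (selected π Φ)

  Addable : Pred (Subset n) 0ℓ → PartialRealization → Pred Item 0ℓ
  Addable ℐ Ψ e = e ∉ dom Ψ × ℐ (dom Ψ ∪ ⁅ e ⁆)

  record Distribution : Set where
    field
      mass   : Realization → Carrier
      nonneg : ∀ Φ → 0# ≤ mass Φ
      total  : HasSum mass 1#

  module _ (D : Distribution) where

    open Distribution D

    Integrable : Pred (Realization → Carrier) 0ℓ
    Integrable X = Summable (λ Φ → mass Φ * X Φ)

    𝔼 : (Realization → Carrier) → Carrier
    𝔼 X = ∑ (λ Φ → mass Φ * X Φ)

    𝟙 : Pred Realization 0ℓ → Realization → Carrier
    𝟙 A Φ = if does (em {P = A Φ}) then 1# else 0#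

    ℙ : Pred Realization 0ℓ → Carrier
    ℙ A = 𝔼 (𝟙 A)

    𝔼[_∣_] : (Realization → Carrier) → Pred Realization 0ℓ → Carrier
    𝔼[ X ∣ A ] = 𝔼 (λ Φ → 𝟙 A Φ * X Φ) / ℙ A

    module _ (f : Utility) where

      -- Taking for π the policies that select a fixed set S, integrability
      -- of all f (selected π Φ) Φ amounts to the condition below.  It in turn
      -- yields every expectation used here when f is nonnegative.
      FiniteExpectations : Set
      FiniteExpectations = ∀ S → Integrable (f S)

      f-avg : Policy → Carrier
      f-avg π = 𝔼 (λ Φ → f (selected π Φ) Φ)

      Δ : Item → PartialRealization → Carrier
      Δ e Ψ = 𝔼[ (λ Φ → f (dom Ψ ∪ ⁅ e ⁆) Φ - f (dom Ψ) Φ) ∣ _∼ Ψ ]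

      AdaptiveMonotone : Set
      AdaptiveMonotone = ∀ Ψ → 0# < ℙ (_∼ Ψ) → ∀ e → 0# ≤ Δ e Ψ

      AdaptiveSubmodular : Set
      AdaptiveSubmodular = ∀ Ψ Ψ′ → Ψ ⊑ Ψ′ → 0# < ℙ (_∼ Ψ′) →
                           ∀ e → Δ e Ψ′ ≤ Δ e Ψ

      FeasibleBenefit : Pred (Subset n) 0ℓ → PartialRealization → Pred Carrier 0ℓ
      FeasibleBenefit ℐ Ψ x = ∃ λ e → ℐ (dom Ψ ∪ ⁅ e ⁆) × x ≈ Δ e Ψ

      record IsApproxGreedy (α : Carrier) (ℐ : Pred (Subset n) 0ℓ)
                            (π : Policy) : Set where
        field
          greedy : ∀ Ψ → Observes π Ψ → 0# < ℙ (_∼ Ψ) → ∃ (Addable ℐ Ψ) →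
                   ∃ λ e → select π Ψ ≡ just e × Addable ℐ Ψ e ×
                   (∀ m → IsMaximum _≤_ (FeasibleBenefit ℐ Ψ) m → α * m ≤ Δ e Ψ)
          stop   : ∀ Ψ → Observes π Ψ → 0# < ℙ (_∼ Ψ) → ¬ ∃ (Addable ℐ Ψ) →
                   select π Ψ ≡ nothing

{-# OPTIONS --safe #-}
module Submission where

-- Under a fixed realization let S be the items chosen by π and T those chosen
-- by π*.  Running π* after π can only help, by adaptive monotonicity, and by
-- adaptive submodularity each item e of T then gains at most its benefit after
-- S.  That benefit is charged to a step of π before which e could still be
-- added: the items blocked after k steps form an independent subset of a set in
-- which the first k choices are maximal independent, so there are at most p k
-- of them, and greediness lets each step pay for p items at the price 1/α.
-- Expectations enter only through one identity (HasSum-gain): the expected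
-- conditional benefit of the next item equals the increase in expected utility.

open import Defs
import Algebra.Properties.AbelianGroup as AbelianGroupProperties
import Algebra.Properties.Ring as RingProperties
import Algebra.Properties.Semiring.Mult as SemiringMult
import Algebra.Solver.Ring.NaturalCoefficients.Default as NatSolver
import Data.Fin.Properties as Fin
import Data.List.Relation.Binary.Subset.Propositional as List
import Data.List.Relation.Unary.All as All
import Data.Nat.Base as ℕ
import Data.Nat.Properties as ℕ
import Relation.Binary.Construct.NonStrictToStrict as Strict
import Relation.Binary.Reasoning.PartialOrder as PosetReasoning
open import Axiom.ExcludedMiddle using (ExcludedMiddle)
open import Data.Bool.Base using (if_then_else_)
open import Data.Empty using (⊥-elim)
open import Data.Fin.Base using (Fin; zero; suc)
open import Data.Fin.Subset
  using (Subset; inside; outside; _∈_; _∉_; _⊆_; _∪_; ⁅_⁆; ∣_∣; Nonempty; ⊥)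
open import Data.Fin.Subset.Properties
  using (drop-there; drop-∷-⊆; Empty-unique; ∣⊥∣≡0; ∣p∣≤n; p⊆q⇒∣p∣≤∣q∣; p⊂q⇒∣p∣<∣q∣; p⊆p∪q;
         q⊆p∪q; x∈p∪q⁻; x∈⁅x⁆; x∈⁅y⁆⇒x≡y; ∪-identityʳ; ⊆-antisym; _∈?_; ⊥⊆; ∪-identityˡ;
         ∪-assoc; ∪-comm)
open import Data.List.Base using (List; []; _∷_; _++_; map; deduplicate)
open import Data.List.Membership.Propositional using () renaming (_∈_ to _∈ˡ_)
open import Data.List.Membership.Propositional.Properties
  using (∈-++⁺ˡ; ∈-++⁺ʳ; ∈-++⁻; ∈-∃++; ∈-deduplicate⁺; ∈-map⁺)
open import Data.List.Relation.Unary.AllPairs using ([]; _∷_)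
open import Data.List.Relation.Unary.Any using (here; there)
open import Data.List.Relation.Unary.Unique.DecPropositional.Properties using (deduplicate-!)
open import Data.List.Relation.Unary.Unique.Propositional using (Unique)
open import Data.Maybe.Base using (Maybe; just; nothing; maybe′; is-just)
open import Data.Maybe.Properties using (just-injective)
open import Data.Nat.Base using (ℕ; zero; suc; NonZero)
open import Data.Product.Base using (∃; ∃₂; _×_; _,_; proj₁; proj₂)
open import Data.Sum.Base using (_⊎_; inj₁; inj₂; [_,_]′)
open import Data.Vec.Base as Vec
  using (Vec; []; _∷_; tabulate; here; there; lookup; zipWith; _[_]≔_)
open import Data.Vec.Properties
  using (lookup⇒[]=; []=⇒lookup; lookup∘tabulate; lookup∘update; lookup∘update′; map-[]≔;
         map-replicate; lookup-replicate)
open import Function.Base using (_∘_; id)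
open import Level using (0ℓ)
open import Relation.Binary.Bundles using (Poset)
open import Relation.Binary.Definitions using (DecidableEquality)
open import Relation.Binary.PropositionalEquality.Core as ≡ using (_≡_)
open import Relation.Binary.Structures using (IsTotalOrder)
open import Relation.Nullary.Decidable.Core using (yes; no; does; Dec; decidable-stable)
open import Relation.Nullary.Negation.Core using (¬_)
open import Relation.Unary using (Pred)

-- The constant: weighted by `α`, the expected utility of the union of both runs splits into `α`
-- times the utility of `π` and the gain of the appended `π*`, which costs at most `p` times the
-- utility of `π`; together `p + α`. Weighting benefits by `α` takes the place of dividing by `α`,
-- so `α = 0` is no exception. When `α` is below 1, the gains along the run of `π` may increase from
-- step to step. The charging therefore uses running minima of the gains; it is an Abel summation
-- against the bounds on the numbers of blocked items. `O` is arbitrary, so a run may lead to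
-- infinitely many observations, and the law of total expectation is an exchange of infinite sums.
-- It is obtained by comparing nonnegative families class by class, a class being the realizations
-- with the same observation. The assumptions on `f` and `π` are silent on events of probability
-- zero. The combinatorial argument is thus made for a realization of positive mass; for the others,
-- multiplication by the mass makes the inequality trivial.

-- Arithmetic and order in the real field

module OrderedField (em : ExcludedMiddle 0ℓ) (ℝ : CompleteOrderedField) where

  open CompleteOrderedField ℝ hiding (zero)
  open RingProperties ring using (-‿distribˡ-*; -‿distribʳ-*) public
  open AbelianGroupProperties +-abelianGroup using ()
    renaming (⁻¹-∙-comm to -‿+-comm; ⁻¹-involutive to -‿involutive; ε⁻¹≈ε to -0≈0) public
  open NatSolver commutativeSemiring using (solve; _:=_; _:+_; _:*_) public

  poset : Poset 0ℓ 0ℓ 0ℓ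
  poset = record { isPartialOrder = IsTotalOrder.isPartialOrder isTotalOrder }

  open IsTotalOrder isTotalOrder public using ()
    renaming (total to ≤-total; antisym to ≤-antisym; reflexive to ≤-reflexive;
              trans to ≤-trans; refl to ≤-refl)
  module ≤-Reasoning = PosetReasoning poset
  open ≤-Reasoning

  <⇒≱ : ∀ {x y} → x < y → ¬ y ≤ x
  <⇒≱ = Strict.<⇒≱ _≈_ _≤_ ≤-antisym

  ≮⇒≥ : ∀ {x y} → ¬ x < y → y ≤ x
  ≮⇒≥ {x} {y} x≮y with ≤-total y x
  ... | inj₁ y≤x = y≤x
  ... | inj₂ x≤y with em {P = x ≈ y}
  ...   | yes x≈y = ≤-reflexive (sym x≈y)
  ...   | no  x≉y = ⊥-elim (x≮y (x≤y , x≉y))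

  +-monoʳ-≤ : ∀ z {x y} → x ≤ y → z + x ≤ z + y
  +-monoʳ-≤ z {x} {y} x≤y = begin
    z + x ≈⟨ +-comm z x ⟩
    x + z ≤⟨ +-monoˡ-≤ z x≤y ⟩
    y + z ≈⟨ +-comm y z ⟩
    z + y ∎

  +-mono-≤ : ∀ {w x y z} → w ≤ x → y ≤ z → w + y ≤ x + z
  +-mono-≤ {x = x} {y} w≤x y≤z = ≤-trans (+-monoˡ-≤ y w≤x) (+-monoʳ-≤ x y≤z)

  x+y-y≈x : ∀ x y → x + y - y ≈ x
  x+y-y≈x x y = trans (+-assoc x y (- y)) (trans (+-congˡ (-‿inverseʳ y)) (+-identityʳ x))

  x-y+y≈x : ∀ x y → x - y + y ≈ x
  x-y+y≈x x y = trans (+-assoc x (- y) y) (trans (+-congˡ (-‿inverseˡ y)) (+-identityʳ x))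

  y+[x-y]≈x : ∀ x y → y + (x - y) ≈ x
  y+[x-y]≈x x y = trans (+-comm y (x - y)) (x-y+y≈x x y)

  +-cancelʳ-≤ : ∀ z {x y} → x + z ≤ y + z → x ≤ y
  +-cancelʳ-≤ z {x} {y} x+z≤y+z = begin
    x         ≈⟨ x+y-y≈x x z ⟨
    x + z - z ≤⟨ +-monoˡ-≤ (- z) x+z≤y+z ⟩
    y + z - z ≈⟨ x+y-y≈x y z ⟩
    y         ∎

  +-cancelʳ-≈ : ∀ z {x y} → x + z ≈ y + z → x ≈ y
  +-cancelʳ-≈ z eq =
    ≤-antisym (+-cancelʳ-≤ z (≤-reflexive eq)) (+-cancelʳ-≤ z (≤-reflexive (sym eq)))

  +-monoˡ-< : ∀ z {x y} → x < y → x + z < y + z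
  +-monoˡ-< z (x≤y , x≉y) = +-monoˡ-≤ z x≤y , λ eq → x≉y (+-cancelʳ-≈ z eq)

  +-monoʳ-< : ∀ z {x y} → x < y → z + x < z + y
  +-monoʳ-< z {x} {y} x<y = begin-strict
    z + x ≈⟨ +-comm z x ⟩
    x + z <⟨ +-monoˡ-< z x<y ⟩
    y + z ≈⟨ +-comm y z ⟩
    z + y ∎

  +-mono-< : ∀ {w x y z} → w < x → y < z → w + y < x + z
  +-mono-< {w} {x} {y} {z} w<x y<z = begin-strict
    w + y <⟨ +-monoˡ-< y w<x ⟩
    x + y <⟨ +-monoʳ-< x y<z ⟩
    x + z ∎

  neg-mono-< : ∀ {x y} → x < y → - y < - x
  neg-mono-< {x} {y} x<y = begin-strict
    - y               ≈⟨ cancel x (- y) ⟨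
    x + (- x - y)     <⟨ +-monoˡ-< (- x - y) x<y ⟩
    y + (- x - y)     ≈⟨ +-congˡ (+-comm (- x) (- y)) ⟩
    y + (- y - x)     ≈⟨ cancel y (- x) ⟩
    - x               ∎
    where
    cancel : ∀ a b → a + (- a + b) ≈ b
    cancel a b = trans (sym (+-assoc a (- a) b)) (trans (+-congʳ (-‿inverseʳ a)) (+-identityˡ b))

  x≤x+y : ∀ x {y} → 0# ≤ y → x ≤ x + y
  x≤x+y x 0≤y = ≤-trans (≤-reflexive (sym (+-identityʳ x))) (+-monoʳ-≤ x 0≤y)

  +-nonneg : ∀ {x y} → 0# ≤ x → 0# ≤ y → 0# ≤ x + y
  +-nonneg {x} 0≤x 0≤y = ≤-trans 0≤x (x≤x+y x 0≤y)

  x≤y⇒0≤y-x : ∀ {x y} → x ≤ y → 0# ≤ y - x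
  x≤y⇒0≤y-x {x} {y} x≤y = begin
    0#    ≈⟨ -‿inverseʳ x ⟨
    x - x ≤⟨ +-monoˡ-≤ (- x) x≤y ⟩
    y - x ∎

  x<y⇒0<y-x : ∀ {x y} → x < y → 0# < y - x
  x<y⇒0<y-x {x} {y} x<y = begin-strict
    0#    ≈⟨ -‿inverseʳ x ⟨
    x - x <⟨ +-monoˡ-< (- x) x<y ⟩
    y - x ∎

  *-monoˡ-≤ : ∀ {z x y} → 0# ≤ z → x ≤ y → z * x ≤ z * y
  *-monoˡ-≤ {z} {x} {y} 0≤z x≤y = begin
    z * x               ≤⟨ x≤x+y (z * x) (*-nonneg 0≤z (x≤y⇒0≤y-x x≤y)) ⟩
    z * x + z * (y - x) ≈⟨ distribˡ z x (y - x) ⟨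
    z * (x + (y - x))   ≈⟨ *-congˡ (y+[x-y]≈x y x) ⟩
    z * y               ∎

  *-monoʳ-≤ : ∀ {z x y} → 0# ≤ z → x ≤ y → x * z ≤ y * z
  *-monoʳ-≤ {z} {x} {y} 0≤z x≤y = begin
    x * z ≈⟨ *-comm x z ⟩
    z * x ≤⟨ *-monoˡ-≤ 0≤z x≤y ⟩
    z * y ≈⟨ *-comm z y ⟩
    y * z ∎

  0≤1 : 0# ≤ 1#
  0≤1 with ≤-total 0# 1#
  ... | inj₁ 0≤1 = 0≤1
  ... | inj₂ 1≤0 = begin
    0#              ≤⟨ *-nonneg 0≤-1 0≤-1 ⟩
    (- 1#) * (- 1#) ≈⟨ -‿distribˡ-* 1# (- 1#) ⟨
    - (1# * (- 1#)) ≈⟨ -‿cong (*-identityˡ (- 1#)) ⟩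
    - (- 1#)        ≈⟨ -‿involutive 1# ⟩
    1#              ∎
    where
    0≤-1 : 0# ≤ - 1#
    0≤-1 = ≤-trans (x≤y⇒0≤y-x 1≤0) (≤-reflexive (+-identityˡ (- 1#)))

  0<1 : 0# < 1#
  0<1 = 0≤1 , 0≉1

  0≤fromℕ : ∀ k → 0# ≤ fromℕ k
  0≤fromℕ zero    = ≤-refl
  0≤fromℕ (suc k) = +-nonneg 0≤1 (0≤fromℕ k)

  >⇒≉0 : ∀ {x} → 0# < x → ¬ x ≈ 0#
  >⇒≉0 (_ , 0≉x) x≈0 = 0≉x (sym x≈0)

  ⁻¹-nonneg : ∀ {x} → 0# < x → 0# ≤ x ⁻¹
  ⁻¹-nonneg {x} 0<x with ≤-total 0# (x ⁻¹)
  ... | inj₁ 0≤x⁻¹ = 0≤x⁻¹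
  ... | inj₂ x⁻¹≤0 = ⊥-elim (<⇒≱ 0<1 (begin
    1#       ≈⟨ ⁻¹-inverseʳ x (>⇒≉0 0<x) ⟨
    x * x ⁻¹ ≤⟨ *-monoˡ-≤ (proj₁ 0<x) x⁻¹≤0 ⟩
    x * 0#   ≈⟨ zeroʳ x ⟩
    0#       ∎))

  z*[x/z]≈x : ∀ x {z} → 0# < z → z * (x / z) ≈ x
  z*[x/z]≈x x {z} 0<z = begin-equality
    z * (x * z ⁻¹) ≈⟨ solve 3 (λ z x y → z :* (x :* y) := x :* (z :* y)) refl z x (z ⁻¹) ⟩
    x * (z * z ⁻¹) ≈⟨ *-congˡ (⁻¹-inverseʳ z (>⇒≉0 0<z)) ⟩
    x * 1#         ≈⟨ *-identityʳ x ⟩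
    x              ∎

  *-≤⇒≤-/ : ∀ {x y z} → 0# < z → z * x ≤ y → x ≤ y / z
  *-≤⇒≤-/ {x} {y} {z} 0<z zx≤y = begin
    x            ≈⟨ z*[x/z]≈x x 0<z ⟨
    z * (x / z)  ≈⟨ *-assoc z x (z ⁻¹) ⟨
    z * x / z    ≤⟨ *-monoʳ-≤ (⁻¹-nonneg 0<z) zx≤y ⟩
    y / z        ∎

  halve : ∀ {ε} → 0# < ε → ∃ λ δ → 0# < δ × δ + δ ≈ ε
  halve {ε} 0<ε = ε / 2# , (0≤δ , 0≉δ) , δ+δ≈ε
    where
    2# : Carrier
    2# = 1# + 1#
    0<2 : 0# < 2#
    0<2 = begin-strict
      0#      <⟨ 0<1 ⟩
      1#      ≤⟨ x≤x+y 1# 0≤1 ⟩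
      1# + 1# ∎
    0≤δ : 0# ≤ ε / 2#
    0≤δ = *-nonneg (proj₁ 0<ε) (⁻¹-nonneg 0<2)
    δ+δ≈ε : ε / 2# + ε / 2# ≈ ε
    δ+δ≈ε = begin-equality
      ε / 2# + ε / 2#           ≈⟨ +-cong (*-identityˡ _) (*-identityˡ _) ⟨
      1# * (ε / 2#) + 1# * (ε / 2#) ≈⟨ distribʳ (ε / 2#) 1# 1# ⟨
      2# * (ε / 2#)             ≈⟨ z*[x/z]≈x ε 0<2 ⟩
      ε                         ∎
    0≉δ : ¬ 0# ≈ ε / 2#
    0≉δ 0≈δ = proj₂ 0<ε (begin-equality
      0#              ≈⟨ +-identityʳ 0# ⟨
      0# + 0#         ≈⟨ +-cong 0≈δ 0≈δ ⟩
      ε / 2# + ε / 2# ≈⟨ δ+δ≈ε ⟩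
      ε               ∎)

-- Unconditional sums and their comparison over classes

module SumProperties (em : ExcludedMiddle 0ℓ) (ℝ : CompleteOrderedField) where

  open CompleteOrderedField ℝ hiding (zero)
  open OrderedField em ℝ
  open Summation em ℝ
  open ≤-Reasoning

  _≟_ : {A : Set} → DecidableEquality A
  x ≟ y = em

  indicator : Set → Carrier
  indicator P = if does (em {P = P}) then 1# else 0#

  indicator-yes : ∀ {P} → P → indicator P ≡ 1#
  indicator-yes {P} p with em {P = P}
  ... | yes _ = ≡.refl
  ... | no ¬p = ⊥-elim (¬p p)

  indicator-no : ∀ {P} → ¬ P → indicator P ≡ 0#
  indicator-no {P} ¬p with em {P = P}
  ... | yes p = ⊥-elim (¬p p)
  ... | no  _ = ≡.refl

  indicator-cong : ∀ {P Q} → (P → Q) → (Q → P) → indicator P ≡ indicator Q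
  indicator-cong {P} {Q} to from with em {P = P}
  ... | yes p = ≡.sym (indicator-yes (to p))
  ... | no ¬p = ≡.sym (indicator-no (λ q → ¬p (from q)))

  0≤indicator : ∀ P → 0# ≤ indicator P
  0≤indicator P with em {P = P}
  ... | yes _ = 0≤1
  ... | no  _ = ≤-refl

  indicator≤1 : ∀ P → indicator P ≤ 1#
  indicator≤1 P with em {P = P}
  ... | yes _ = ≤-refl
  ... | no  _ = 0≤1

  indicator-*-≤ : ∀ P {x} → 0# ≤ x → indicator P * x ≤ x
  indicator-*-≤ P 0≤x = ≤-trans (*-monoʳ-≤ 0≤x (indicator≤1 P)) (≤-reflexive (*-identityˡ _))

  indicator-⊎ : ∀ {P Q} → (P → ¬ Q) → indicator (P ⊎ Q) ≈ indicator P + indicator Q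
  indicator-⊎ {P} {Q} disjoint with em {P = P}
  ... | yes p = begin-equality
    indicator (P ⊎ Q) ≡⟨ indicator-yes (inj₁ p) ⟩
    1#                ≈⟨ +-identityʳ 1# ⟨
    1# + 0#           ≡⟨ ≡.cong (1# +_) (indicator-no (disjoint p)) ⟨
    1# + indicator Q  ∎
  ... | no ¬p = begin-equality
    indicator (P ⊎ Q) ≡⟨ indicator-cong (λ { (inj₁ p) → ⊥-elim (¬p p) ; (inj₂ q) → q }) inj₂ ⟩
    indicator Q       ≈⟨ +-identityˡ (indicator Q) ⟨
    0# + indicator Q  ∎

  module _ {I : Set} where

    finiteSum-mono : ∀ {u v : I → Carrier} F → (∀ x → x ∈ˡ F → u x ≤ v x) →
                     finiteSum u F ≤ finiteSum v F
    finiteSum-mono []      u≤v = ≤-refl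
    finiteSum-mono (x ∷ F) u≤v =
      +-mono-≤ (u≤v x (here ≡.refl)) (finiteSum-mono F (λ y y∈F → u≤v y (there y∈F)))

    finiteSum-cong : ∀ {u v : I → Carrier} F → (∀ x → u x ≈ v x) →
                     finiteSum u F ≈ finiteSum v F
    finiteSum-cong []      u≈v = refl
    finiteSum-cong (x ∷ F) u≈v = +-cong (u≈v x) (finiteSum-cong F u≈v)

    finiteSum-+ : ∀ (u v : I → Carrier) F →
                  finiteSum (λ x → u x + v x) F ≈ finiteSum u F + finiteSum v F
    finiteSum-+ u v []      = sym (+-identityʳ 0#)
    finiteSum-+ u v (x ∷ F) = trans (+-congˡ (finiteSum-+ u v F))
      (solve 4 (λ a b c d → (a :+ b) :+ (c :+ d) := (a :+ c) :+ (b :+ d)) refl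
        (u x) (v x) (finiteSum u F) (finiteSum v F))

    finiteSum-neg : ∀ (u : I → Carrier) F → finiteSum (λ x → - u x) F ≈ - finiteSum u F
    finiteSum-neg u []      = sym -0≈0
    finiteSum-neg u (x ∷ F) = trans (+-congˡ (finiteSum-neg u F)) (-‿+-comm (u x) (finiteSum u F))

    finiteSum-*ˡ : ∀ c (u : I → Carrier) F →
                   finiteSum (λ x → c * u x) F ≈ c * finiteSum u F
    finiteSum-*ˡ c u []      = sym (zeroʳ c)
    finiteSum-*ˡ c u (x ∷ F) =
      trans (+-congˡ (finiteSum-*ˡ c u F)) (sym (distribˡ c (u x) (finiteSum u F)))

    finiteSum-nonneg : ∀ {u : I → Carrier} → (∀ x → 0# ≤ u x) → ∀ F → 0# ≤ finiteSum u F
    finiteSum-nonneg 0≤u []      = ≤-refl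
    finiteSum-nonneg 0≤u (x ∷ F) = +-nonneg (0≤u x) (finiteSum-nonneg 0≤u F)

    finiteSum-extract : ∀ (u : I → Carrier) x F G →
                        finiteSum u (F ++ x ∷ G) ≈ u x + finiteSum u (F ++ G)
    finiteSum-extract u x []      G = refl
    finiteSum-extract u x (y ∷ F) G = trans (+-congˡ (finiteSum-extract u x F G))
      (solve 3 (λ a b c → a :+ (b :+ c) := b :+ (a :+ c)) refl
        (u y) (u x) (finiteSum u (F ++ G)))

    -- Each element of `F` is cut out of `G` at one occurrence; uniqueness of `F` keeps the rest of
    -- `F` inside what remains. Repetitions in `G` only add nonnegative terms.
    finiteSum-⊆ : ∀ {u : I → Carrier} → (∀ x → 0# ≤ u x) → ∀ {F G} →
                  Unique F → F List.⊆ G → finiteSum u F ≤ finiteSum u G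
    finiteSum-⊆ 0≤u {[]}    {G} []        F⊆G = finiteSum-nonneg 0≤u G
    finiteSum-⊆ {u} 0≤u {x ∷ F} {G} (x∉F ∷ F!) F⊆G with ∈-∃++ (F⊆G (here ≡.refl))
    ... | G₁ , G₂ , ≡.refl = begin
      u x + finiteSum u F          ≤⟨ +-monoʳ-≤ (u x) (finiteSum-⊆ 0≤u F! F⊆G₁++G₂) ⟩
      u x + finiteSum u (G₁ ++ G₂) ≈⟨ finiteSum-extract u x G₁ G₂ ⟨
      finiteSum u (G₁ ++ x ∷ G₂)   ∎
      where
      F⊆G₁++G₂ : F List.⊆ (G₁ ++ G₂)
      F⊆G₁++G₂ y∈F with ∈-++⁻ G₁ (F⊆G (there y∈F))
      ... | inj₁ y∈G₁             = ∈-++⁺ˡ y∈G₁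
      ... | inj₂ (here ≡.refl)    = ⊥-elim (All.lookup x∉F y∈F ≡.refl)
      ... | inj₂ (there y∈G₂)     = ∈-++⁺ʳ G₁ y∈G₂

    join : List I → List I → List I
    join F G = deduplicate _≟_ (F ++ G)

    join! : ∀ F G → Unique (join F G)
    join! F G = deduplicate-! _≟_ (F ++ G)

    ⊆-joinˡ : ∀ F G → F List.⊆ join F G
    ⊆-joinˡ F G x∈F = ∈-deduplicate⁺ _≟_ (∈-++⁺ˡ x∈F)

    ⊆-joinʳ : ∀ F G → G List.⊆ join F G
    ⊆-joinʳ F G x∈G = ∈-deduplicate⁺ _≟_ (∈-++⁺ʳ F x∈G)

    HasSum-mono : ∀ {u v : I → Carrier} {s t} → (∀ x → u x ≤ v x) →
                  HasSum u s → HasSum v t → s ≤ t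
    HasSum-mono {u} {v} {s} {t} u≤v us vt = ≮⇒≥ λ t<s →
      -- Half the gap makes `t + δ` equal to `s - δ`, so the strict chain below leads from `t + δ`
      -- back to itself.
      let δ , 0<δ , δ+δ≈s-t = halve (x<y⇒0<y-x t<s)
          F , near-s = us δ 0<δ
          G , near-t = vt δ 0<δ
          H = join F G
      in <⇒≱ (begin-strict
        t + δ         ≈⟨ x+y-y≈x (t + δ) δ ⟨
        t + δ + δ - δ ≈⟨ +-congʳ (trans (+-assoc t δ δ) (trans (+-congˡ δ+δ≈s-t) (y+[x-y]≈x s t))) ⟩
        s - δ         <⟨ proj₁ (near-s H (join! F G) (⊆-joinˡ F G)) ⟩
        finiteSum u H ≤⟨ finiteSum-mono H (λ x _ → u≤v x) ⟩
        finiteSum v H <⟨ proj₂ (near-t H (join! F G) (⊆-joinʳ F G)) ⟩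
        t + δ         ∎) ≤-refl

    HasSum-unique : ∀ {u : I → Carrier} {s t} → HasSum u s → HasSum u t → s ≈ t
    HasSum-unique us ut =
      ≤-antisym (HasSum-mono (λ _ → ≤-refl) us ut) (HasSum-mono (λ _ → ≤-refl) ut us)

    ∑-unique : ∀ {u : I → Carrier} {s} → HasSum u s → ∑ u ≈ s
    ∑-unique {u} us with em {P = Summable u}
    ... | yes (t , ut) = HasSum-unique ut us
    ... | no  u↑       = ⊥-elim (u↑ (_ , us))

    HasSum-∑ : ∀ {u : I → Carrier} → Summable u → HasSum u (∑ u)
    HasSum-∑ {u} u↓ with em {P = Summable u}
    ... | yes (t , ut) = ut
    ... | no  u↑       = ⊥-elim (u↑ u↓)

    HasSum-cong : ∀ {u v : I → Carrier} {s t} → (∀ x → u x ≈ v x) → s ≈ t →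
                  HasSum u s → HasSum v t
    HasSum-cong {u} {v} {s} {t} u≈v s≈t us ε 0<ε =
      let F , near = us ε 0<ε in
      F , λ G G! F⊆G →
        (begin-strict
          t - ε         ≈⟨ +-congʳ s≈t ⟨
          s - ε         <⟨ proj₁ (near G G! F⊆G) ⟩
          finiteSum u G ≈⟨ finiteSum-cong G u≈v ⟩
          finiteSum v G ∎) ,
        (begin-strict
          finiteSum v G ≈⟨ finiteSum-cong G u≈v ⟨
          finiteSum u G <⟨ proj₂ (near G G! F⊆G) ⟩
          s + ε         ≈⟨ +-congʳ s≈t ⟩
          t + ε         ∎)

    HasSum-+ : ∀ {u v : I → Carrier} {s t} → HasSum u s → HasSum v t →
               HasSum (λ x → u x + v x) (s + t)
    HasSum-+ {u} {v} {s} {t} us vt ε 0<ε =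
      let δ , 0<δ , δ+δ≈ε = halve 0<ε
          F , near-s = us δ 0<δ
          G , near-t = vt δ 0<δ
      in F ++ G , λ H H! F++G⊆H →
        let s-δ< , <s+δ = near-s H H! (λ x∈F → F++G⊆H (∈-++⁺ˡ x∈F))
            t-δ< , <t+δ = near-t H H! (λ x∈G → F++G⊆H (∈-++⁺ʳ F x∈G))
        in
        (begin-strict
          s + t - ε                     ≈⟨ +-congˡ (-‿cong δ+δ≈ε) ⟨
          s + t - (δ + δ)               ≈⟨ +-congˡ (-‿+-comm δ δ) ⟨
          s + t + (- δ - δ)             ≈⟨ interchange s t (- δ) (- δ) ⟩
          (s - δ) + (t - δ)             <⟨ +-mono-< s-δ< t-δ< ⟩
          finiteSum u H + finiteSum v H ≈⟨ finiteSum-+ u v H ⟨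
          finiteSum _ H                 ∎) ,
        (begin-strict
          finiteSum _ H                 ≈⟨ finiteSum-+ u v H ⟩
          finiteSum u H + finiteSum v H <⟨ +-mono-< <s+δ <t+δ ⟩
          (s + δ) + (t + δ)             ≈⟨ interchange s δ t δ ⟩
          s + t + (δ + δ)               ≈⟨ +-congˡ δ+δ≈ε ⟩
          s + t + ε                     ∎)
      where
      interchange : ∀ a b c d → (a + b) + (c + d) ≈ (a + c) + (b + d)
      interchange = solve 4 (λ a b c d → (a :+ b) :+ (c :+ d) := (a :+ c) :+ (b :+ d)) refl

    HasSum-neg : ∀ {u : I → Carrier} {s} → HasSum u s → HasSum (λ x → - u x) (- s)
    HasSum-neg {u} {s} us ε 0<ε =
      let F , near = us ε 0<ε in
      F , λ G G! F⊆G →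
        (begin-strict
          - s - ε                     ≈⟨ -‿+-comm s ε ⟩
          - (s + ε)                   <⟨ neg-mono-< (proj₂ (near G G! F⊆G)) ⟩
          - finiteSum u G             ≈⟨ finiteSum-neg u G ⟨
          finiteSum (λ x → - u x) G   ∎) ,
        (begin-strict
          finiteSum (λ x → - u x) G   ≈⟨ finiteSum-neg u G ⟩
          - finiteSum u G             <⟨ neg-mono-< (proj₁ (near G G! F⊆G)) ⟩
          - (s - ε)                   ≈⟨ -‿+-comm s (- ε) ⟨
          - s - (- ε)                 ≈⟨ +-congˡ (-‿involutive ε) ⟩
          - s + ε                     ∎)

    HasSum-0 : ∀ {u : I → Carrier} → (∀ x → u x ≈ 0#) → HasSum u 0#
    HasSum-0 {u} u≈0 ε 0<ε = [] , λ F _ _ →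
      (begin-strict
        0# - ε        ≈⟨ +-identityˡ (- ε) ⟩
        - ε           <⟨ neg-mono-< 0<ε ⟩
        - 0#          ≈⟨ -0≈0 ⟩
        0#            ≈⟨ zeros F ⟨
        finiteSum u F ∎) ,
      (begin-strict
        finiteSum u F ≈⟨ zeros F ⟩
        0#            <⟨ 0<ε ⟩
        ε             ≈⟨ +-identityˡ ε ⟨
        0# + ε        ∎)
      where
      zeros : ∀ F → finiteSum u F ≈ 0#
      zeros []      = refl
      zeros (x ∷ F) = trans (+-cong (u≈0 x) (zeros F)) (+-identityʳ 0#)

    HasSum-least : ∀ {u : I → Carrier} {s b} → HasSum u s →
                   (∀ F → Unique F → finiteSum u F ≤ b) → s ≤ b
    HasSum-least {u} {s} {b} us bound = ≮⇒≥ λ b<s →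
      let F , near = us (s - b) (x<y⇒0<y-x b<s)
          -- The list supplied by `HasSum` may contain repetitions; joining it with `[]` removes
          -- them.
          G = join F []
      in <⇒≱ (begin-strict
        b             ≈⟨ x+y-y≈x b (s - b) ⟨
        b + (s - b) - (s - b) ≈⟨ +-congʳ (y+[x-y]≈x s b) ⟩
        s - (s - b)   <⟨ proj₁ (near G (join! F []) (⊆-joinˡ F [])) ⟩
        finiteSum u G ∎) (bound G (join! F []))

    finiteSum≤HasSum : ∀ {u : I → Carrier} {s} → (∀ x → 0# ≤ u x) → HasSum u s →
                       ∀ F → Unique F → finiteSum u F ≤ s
    finiteSum≤HasSum {u} {s} 0≤u us F F! = ≮⇒≥ λ s<F →
      let ε = finiteSum u F - s
          G , near = us ε (x<y⇒0<y-x s<F)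
          H = join F G
      in <⇒≱ (begin-strict
        finiteSum u H <⟨ proj₂ (near H (join! F G) (⊆-joinʳ F G)) ⟩
        s + ε         ≈⟨ y+[x-y]≈x (finiteSum u F) s ⟩
        finiteSum u F ∎) (finiteSum-⊆ 0≤u F! (⊆-joinˡ F G))

    -- Completeness of the field enters here: the limit is the supremum of the finite sums, and
    -- nonnegativity keeps the sums over all larger lists near it.
    bounded⇒HasSum : ∀ {u : I → Carrier} {b} → (∀ x → 0# ≤ u x) →
                     (∀ F → Unique F → finiteSum u F ≤ b) →
                     ∃ λ s → HasSum u s × s ≤ b
    bounded⇒HasSum {u} {b} 0≤u bound = s , us , least b isBound
      where
      FiniteSums : Carrier → Set
      FiniteSums x = ∃ λ F → Unique F × x ≈ finiteSum u F

      isBound : UpperBound FiniteSums b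
      isBound x (F , F! , x≈) = ≤-trans (≤-reflexive x≈) (bound F F!)

      sup = complete FiniteSums (0# , [] , [] , refl) (b , isBound)
      s   = proj₁ sup
      least = proj₂ (proj₂ sup)

      ≤s : ∀ F → Unique F → finiteSum u F ≤ s
      ≤s F F! = proj₁ (proj₂ sup) _ (F , F! , refl)

      s-ε<s : ∀ {ε} → 0# < ε → s - ε < s
      s-ε<s {ε} 0<ε = begin-strict
        s - ε     ≈⟨ +-identityʳ (s - ε) ⟨
        s - ε + 0# <⟨ +-monoʳ-< (s - ε) 0<ε ⟩
        s - ε + ε ≈⟨ x-y+y≈x s ε ⟩
        s         ∎

      s<s+ε : ∀ {ε} → 0# < ε → s < s + ε
      s<s+ε {ε} 0<ε = begin-strict
        s      ≈⟨ +-identityʳ s ⟨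
        s + 0# <⟨ +-monoʳ-< s 0<ε ⟩
        s + ε  ∎

      us : HasSum u s
      us ε 0<ε with em {P = ∃ λ F → Unique F × s - ε < finiteSum u F}
      ... | yes (F , F! , s-ε<F) = F , λ G G! F⊆G →
        (begin-strict
          s - ε         <⟨ s-ε<F ⟩
          finiteSum u F ≤⟨ finiteSum-⊆ 0≤u F! F⊆G ⟩
          finiteSum u G ∎) ,
        (begin-strict
          finiteSum u G ≤⟨ ≤s G G! ⟩
          s             <⟨ s<s+ε 0<ε ⟩
          s + ε         ∎)
      ... | no none = ⊥-elim (<⇒≱ (s-ε<s 0<ε) (least (s - ε) λ x (F , F! , x≈) →
        ≤-trans (≤-reflexive x≈) (≮⇒≥ λ s-ε<F → none (F , F! , s-ε<F))))

    dominated : ∀ {u v : I → Carrier} {t} → (∀ x → 0# ≤ u x) → (∀ x → u x ≤ v x) →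
                HasSum v t → Summable u
    dominated {u} {v} {t} 0≤u u≤v vt = let s , us , _ = bounded⇒HasSum 0≤u bound in s , us
      where
      bound : ∀ F → Unique F → finiteSum u F ≤ t
      bound F F! = ≤-trans (finiteSum-mono F (λ x _ → u≤v x))
                           (finiteSum≤HasSum (λ x → ≤-trans (0≤u x) (u≤v x)) vt F F!)

    -- For nonnegative families the limit is the least bound of the finite sums, so both
    -- inequalities come from bounds on finite sums; division by `c` is confined to the case of
    -- nonzero `c`.
    HasSum-*ˡ : ∀ {u : I → Carrier} {c s} → 0# ≤ c → (∀ x → 0# ≤ u x) →
                HasSum u s → HasSum (λ x → c * u x) (c * s)
    HasSum-*ˡ {u} {c} {s} 0≤c 0≤u us =
      HasSum-cong (λ _ → refl) (≤-antisym t≤cs cs≤t) cut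
      where
      scaled = bounded⇒HasSum (λ x → *-nonneg 0≤c (0≤u x)) λ F F! → begin
        finiteSum (λ x → c * u x) F ≈⟨ finiteSum-*ˡ c u F ⟩
        c * finiteSum u F           ≤⟨ *-monoˡ-≤ 0≤c (finiteSum≤HasSum 0≤u us F F!) ⟩
        c * s                       ∎
      t    = proj₁ scaled
      cut  = proj₁ (proj₂ scaled)
      t≤cs = proj₂ (proj₂ scaled)
      cs≤t : c * s ≤ t
      cs≤t with em {P = 0# ≈ c}
      ... | yes 0≈c = begin
        c * s  ≈⟨ *-congʳ 0≈c ⟨
        0# * s ≈⟨ zeroˡ s ⟩
        0#     ≤⟨ finiteSum≤HasSum (λ x → *-nonneg 0≤c (0≤u x)) cut [] [] ⟩
        t      ∎
      ... | no 0≉c = begin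
        c * s       ≤⟨ *-monoˡ-≤ 0≤c (HasSum-least us λ F F! → *-≤⇒≤-/ (0≤c , 0≉c) (begin
          c * finiteSum u F           ≈⟨ finiteSum-*ˡ c u F ⟨
          finiteSum (λ x → c * u x) F ≤⟨ finiteSum≤HasSum (λ x → *-nonneg 0≤c (0≤u x)) cut F F! ⟩
          t                           ∎)) ⟩
        c * (t / c) ≈⟨ z*[x/z]≈x t (0≤c , 0≉c) ⟩
        t           ∎

    -- Every finite set of indices meets only finitely many classes of c, so
    -- the comparison needs only finite additivity of sums over classes.
    HasSum-classwise-≤ :
      {K : Set} (c : I → K) {u v : I → Carrier} → (∀ x → 0# ≤ u x) → (∀ x → 0# ≤ v x) →
      (∀ x → ∃₂ λ s t → s ≤ t × HasSum (λ y → indicator (c y ≡ c x) * u y) s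
                              × HasSum (λ y → indicator (c y ≡ c x) * v y) t) →
      ∀ {b} → HasSum v b → ∃ λ a → HasSum u a × a ≤ b
    HasSum-classwise-≤ c {u} {v} 0≤u 0≤v classwise {b} vb = bounded⇒HasSum 0≤u bound
      where
      On : List I → I → Set
      On F y = c y ∈ˡ map c F

      onClasses : ∀ F → ∃₂ λ s t → s ≤ t × HasSum (λ y → indicator (On F y) * u y) s
                                         × HasSum (λ y → indicator (On F y) * v y) t
      onClasses [] = 0# , 0# , ≤-refl , HasSum-0 (empty u) , HasSum-0 (empty v)
        where
        empty : ∀ (w : I → Carrier) y → indicator (On [] y) * w y ≈ 0#
        empty w y = trans (*-congʳ (reflexive (indicator-no λ ()))) (zeroˡ (w y))
      onClasses (x ∷ F) with em {P = On F x} | onClasses F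
      -- A class that `F` already meets must not be counted twice.
      ... | yes old | s , t , s≤t , us , vt = s , t , s≤t , extend u us , extend v vt
        where
        extend : ∀ w {s} → HasSum (λ y → indicator (On F y) * w y) s →
                 HasSum (λ y → indicator (On (x ∷ F) y) * w y) s
        extend w = HasSum-cong (λ y → *-congʳ (reflexive (indicator-cong there
          λ { (here eq) → ≡.subst (_∈ˡ map c F) (≡.sym eq) old ; (there y∈F) → y∈F }))) refl
      ... | no new | s , t , s≤t , us , vt =
        let s′ , t′ , s′≤t′ , us′ , vt′ = classwise x in
        s′ + s , t′ + t , +-mono-≤ s′≤t′ s≤t , extend u us′ us , extend v vt′ vt
        where
        extend : ∀ w {s s′} → HasSum (λ y → indicator (c y ≡ c x) * w y) s′ →
                 HasSum (λ y → indicator (On F y) * w y) s →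
                 HasSum (λ y → indicator (On (x ∷ F) y) * w y) (s′ + s)
        extend w ws′ ws = HasSum-cong (λ y → sym (begin-equality
            indicator (On (x ∷ F) y) * w y
              ≡⟨ ≡.cong (_* w y) (indicator-cong
                   (λ { (here eq) → inj₁ eq ; (there y∈F) → inj₂ y∈F })
                   (λ { (inj₁ eq) → here eq ; (inj₂ y∈F) → there y∈F })) ⟩
            indicator (c y ≡ c x ⊎ On F y) * w y
              ≈⟨ *-congʳ (indicator-⊎ λ eq y∈F → new (≡.subst (_∈ˡ map c F) eq y∈F)) ⟩
            (indicator (c y ≡ c x) + indicator (On F y)) * w y
              ≈⟨ distribʳ (w y) _ _ ⟩
            indicator (c y ≡ c x) * w y + indicator (On F y) * w y ∎)) refl (HasSum-+ ws′ ws)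

      bound : ∀ F → Unique F → finiteSum u F ≤ b
      bound F F! =
        -- Nonnegativity serves twice: to enlarge the sum of `u` from `F` to the classes it meets,
        -- and to bound the sum of `v` over these classes by the full sum.
        let s , t , s≤t , us , vt = onClasses F in begin
        finiteSum u F                                 ≤⟨ finiteSum-mono F (λ x x∈F → ≤-reflexive (sym
          (trans (*-congʳ (reflexive (indicator-yes (∈-map⁺ c x∈F)))) (*-identityˡ (u x))))) ⟩
        finiteSum (λ y → indicator (On F y) * u y) F  ≤⟨ finiteSum≤HasSum
          (λ y → *-nonneg (0≤indicator (On F y)) (0≤u y)) us F F! ⟩
        s                                             ≤⟨ s≤t ⟩
        t                                             ≤⟨ HasSum-mono
          (λ y → indicator-*-≤ (On F y) (0≤v y)) vt vb ⟩
        b                                             ∎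

-- Unions and sizes of finite subsets

∪-⊆ : ∀ {n} {p q r : Subset n} → p ⊆ r → q ⊆ r → p ∪ q ⊆ r
∪-⊆ {p = p} {q} p⊆r q⊆r x∈p∪q = [ p⊆r , q⊆r ]′ (x∈p∪q⁻ p q x∈p∪q)

⁅x⁆⊆ : ∀ {n} {x} {p : Subset n} → x ∈ p → ⁅ x ⁆ ⊆ p
⁅x⁆⊆ {x = x} {p} x∈p y∈⁅x⁆ = ≡.subst (_∈ p) (≡.sym (x∈⁅y⁆⇒x≡y x y∈⁅x⁆)) x∈p

∪-absorb : ∀ {n} {p q : Subset n} → q ⊆ p → p ∪ q ≡ p
∪-absorb {q = q} q⊆p = ⊆-antisym (∪-⊆ id q⊆p) (p⊆p∪q q)

∪-monoˡ-⊆ : ∀ {n} {p q : Subset n} r → p ⊆ q → p ∪ r ⊆ q ∪ r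
∪-monoˡ-⊆ {q = q} r p⊆q = ∪-⊆ (λ x∈p → p⊆p∪q r (p⊆q x∈p)) (q⊆p∪q q r)

∣p∣<∣p∪⁅x⁆∣ : ∀ {n} {x} (p : Subset n) → x ∉ p → ∣ p ∣ ℕ.< ∣ p ∪ ⁅ x ⁆ ∣
∣p∣<∣p∪⁅x⁆∣ {x = x} p x∉p =
  p⊂q⇒∣p∣<∣q∣ (p⊆p∪q ⁅ x ⁆ , x , q⊆p∪q p ⁅ x ⁆ (x∈⁅x⁆ x) , x∉p)

∣p∪⁅x⁆∣≤1+∣p∣ : ∀ {n} (p : Subset n) x → ∣ p ∪ ⁅ x ⁆ ∣ ℕ.≤ suc ∣ p ∣
∣p∪⁅x⁆∣≤1+∣p∣ (inside  ∷ p) zero    rewrite ∪-identityʳ p = ℕ.n≤1+n _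
∣p∪⁅x⁆∣≤1+∣p∣ (outside ∷ p) zero    rewrite ∪-identityʳ p = ℕ.≤-refl
∣p∪⁅x⁆∣≤1+∣p∣ (inside  ∷ p) (suc x) = ℕ.s≤s (∣p∪⁅x⁆∣≤1+∣p∣ p x)
∣p∪⁅x⁆∣≤1+∣p∣ (outside ∷ p) (suc x) = ∣p∪⁅x⁆∣≤1+∣p∣ p x

-- Maximal independent sets and the ratio bound

module Classical (em : ExcludedMiddle 0ℓ) where

  module _ {n : ℕ} {P : Pred (Fin n) 0ℓ} where

    comprehension : Subset n
    comprehension = tabulate (λ x → does (em {P = P x}))

    ∈-comprehension⁺ : ∀ {x} → P x → x ∈ comprehension
    ∈-comprehension⁺ {x} px =
      lookup⇒[]= x _ (≡.trans (lookup∘tabulate (λ y → does (em {P = P y})) x) holds)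
      where
      holds : does (em {P = P x}) ≡ inside
      holds with em {P = P x}
      ... | yes _  = ≡.refl
      ... | no ¬px = ⊥-elim (¬px px)

    ∈-comprehension⁻ : ∀ {x} → x ∈ comprehension → P x
    ∈-comprehension⁻ {x} x∈ = holds
      (≡.trans (≡.sym (lookup∘tabulate (λ y → does (em {P = P y})) x)) ([]=⇒lookup x∈))
      where
      holds : does (em {P = P x}) ≡ inside → P x
      holds eq with em {P = P x}
      ... | yes px = px

  minimum-exists : ∀ {P : Pred ℕ 0ℓ} b {k} → k ℕ.≤ b → P k → ∃ (IsMinimum ℕ._≤_ P)
  minimum-exists zero    ℕ.z≤n pk = 0 , pk , λ _ _ → ℕ.z≤n
  minimum-exists {P} (suc b) {k} k≤1+b pk with em {P = ∃ λ j → j ℕ.≤ b × P j}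
  ... | yes (j , j≤b , pj) = minimum-exists b j≤b pj
  ... | no none = k , pk , λ j pj → ℕ.≤-trans k≤1+b (ℕ.≰⇒> λ j≤b → none (j , j≤b , pj))

  maximum-exists : ∀ {P : Pred ℕ 0ℓ} b → (∀ k → P k → k ℕ.≤ b) → ∃ P → ∃ (IsMaximum ℕ._≤_ P)
  maximum-exists {P} b bound (k , pk) with em {P = P b}
  ... | yes pb = b , pb , bound
  maximum-exists zero bound (k , pk) | no ¬p0 with bound k pk
  ... | ℕ.z≤n = ⊥-elim (¬p0 pk)
  maximum-exists {P} (suc b) bound ∃P | no ¬p1+b = maximum-exists b bound′ ∃P
    where
    bound′ : ∀ k → P k → k ℕ.≤ b
    bound′ k pk = ℕ.≤-pred (ℕ.≤∧≢⇒< (bound k pk) λ { ≡.refl → ¬p1+b pk })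

  module _ {n : ℕ} {ℐ : Pred (Subset n) 0ℓ} where

    -- `k` is fuel: it bounds the number of items that can still be added, because no subset has
    -- more than `n` elements.
    extend-to-maximal : ∀ {C} k T → n ℕ.≤ ∣ T ∣ ℕ.+ k → T ⊆ C → ℐ T →
                        ∃ λ B → MaximalIndependent ℐ C B × T ⊆ B
    extend-to-maximal {C} k T n≤∣T∣+k T⊆C T∈ℐ
      with em {P = ∃ λ e → e ∈ C × e ∉ T × ℐ (T ∪ ⁅ e ⁆)}
    ... | no none = T , ((λ {x} → T⊆C {x}) , T∈ℐ , λ e e∈C e∉T T∪e∈ℐ → none (e , e∈C , e∉T , T∪e∈ℐ)) , id
    extend-to-maximal {C} zero T n≤∣T∣+0 T⊆C T∈ℐ | yes (e , e∈C , e∉T , T∪e∈ℐ) =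
      ⊥-elim (ℕ.<⇒≱ (∣p∣<∣p∪⁅x⁆∣ T e∉T)
        (ℕ.≤-trans (∣p∣≤n (T ∪ ⁅ e ⁆)) (≡.subst (n ℕ.≤_) (ℕ.+-identityʳ ∣ T ∣) n≤∣T∣+0)))
    extend-to-maximal {C} (suc k) T n≤∣T∣+1+k T⊆C T∈ℐ | yes (e , e∈C , e∉T , T∪e∈ℐ) =
      let B , maximal , T∪e⊆B = extend-to-maximal k (T ∪ ⁅ e ⁆)
            (ℕ.≤-trans (≡.subst (n ℕ.≤_) (ℕ.+-suc ∣ T ∣ k) n≤∣T∣+1+k) (ℕ.+-monoˡ-≤ k (∣p∣<∣p∪⁅x⁆∣ T e∉T)))
            (∪-⊆ T⊆C (⁅x⁆⊆ e∈C)) T∪e∈ℐ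
      in B , maximal , λ x∈T → T∪e⊆B (p⊆p∪q ⁅ e ⁆ x∈T)

    -- `T` need not be maximal in `C`, so it is first extended to a maximal `B`; the ratio axiom
    -- then compares `B` with `S` through the extreme sizes. The axiom speaks of nonempty `C`, hence
    -- the separate empty case.
    independent-size-≤ : ∀ {p} → IsIndependenceSystem p ℐ → ∀ {C S T} →
                         MaximalIndependent ℐ C S → T ⊆ C → ℐ T → ∣ T ∣ ℕ.≤ p ℕ.* ∣ S ∣
    independent-size-≤ {p} isIndep {C} {S} {T} S-maximal T⊆C T∈ℐ with em {P = Nonempty C}
    ... | no  empty = ≡.subst (ℕ._≤ p ℕ.* ∣ S ∣) (≡.sym ∣T∣≡0) ℕ.z≤n
      where
      ∣T∣≡0 : ∣ T ∣ ≡ 0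
      ∣T∣≡0 = ≡.trans (≡.cong ∣_∣ (Empty-unique {p = T} λ { (x , x∈T) → empty (x , T⊆C x∈T) })) (∣⊥∣≡0 n)
    ... | yes C≠∅ =
      let B , B-maximal , T⊆B = extend-to-maximal n T (ℕ.m≤n+m n ∣ T ∣) T⊆C T∈ℐ
          M , isMax = maximum-exists {P = MaximalSize ℐ C} n
            (λ { _ (B , _ , ≡.refl) → ∣p∣≤n B }) (∣ B ∣ , B , B-maximal , ≡.refl)
          m , isMin = minimum-exists {P = MaximalSize ℐ C} ∣ S ∣ ℕ.≤-refl (S , S-maximal , ≡.refl)
      in begin
        ∣ T ∣       ≤⟨ p⊆q⇒∣p∣≤∣q∣ T⊆B ⟩
        ∣ B ∣       ≤⟨ proj₂ isMax ∣ B ∣ (B , B-maximal , ≡.refl) ⟩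
        M           ≤⟨ IsIndependenceSystem.ratio isIndep C C≠∅ isMax isMin ⟩
        p ℕ.* m     ≤⟨ ℕ.*-monoʳ-≤ p (proj₂ isMin ∣ S ∣ (S , S-maximal , ≡.refl)) ⟩
        p ℕ.* ∣ S ∣ ∎
      where open ℕ.≤-Reasoning

-- Charging item weights to steps

module Charging (em : ExcludedMiddle 0ℓ) (ℝ : CompleteOrderedField) where

  open CompleteOrderedField ℝ hiding (zero)
  open OrderedField em ℝ
  open ≤-Reasoning
  open SemiringMult semiring using (×-homo-+)

  fromℕ-+ : ∀ j k → fromℕ (j ℕ.+ k) ≈ fromℕ j + fromℕ k
  fromℕ-+ = ×-homo-+ 1#

  sumTo : (ℕ → Carrier) → ℕ → Carrier
  sumTo g zero    = 0#
  sumTo g (suc k) = sumTo g k + g k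

  weight : ∀ {n} → Subset n → (Fin n → Carrier) → Carrier
  weight []            v = 0#
  weight (inside  ∷ U) v = v zero + weight U (v ∘ suc)
  weight (outside ∷ U) v = weight U (v ∘ suc)

  weight-⊥ : ∀ n (v : Fin n → Carrier) → weight ⊥ v ≡ 0#
  weight-⊥ zero    v = ≡.refl
  weight-⊥ (suc n) v = weight-⊥ n (v ∘ suc)

  weight-insert : ∀ {n} (U : Subset n) v {x} → x ∉ U → weight (U ∪ ⁅ x ⁆) v ≈ weight U v + v x
  weight-insert (inside  ∷ U) v {zero}  x∉U = ⊥-elim (x∉U here)
  weight-insert (outside ∷ U) v {zero}  x∉U rewrite ∪-identityʳ U = +-comm (v zero) _
  weight-insert (inside  ∷ U) v {suc x} x∉U =
    trans (+-congˡ (weight-insert U (v ∘ suc) (λ x∈U → x∉U (there x∈U)))) (sym (+-assoc (v zero) _ _))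
  weight-insert (outside ∷ U) v {suc x} x∉U = weight-insert U (v ∘ suc) (λ x∈U → x∉U (there x∈U))

  -- weight U′ − weight U ≤ (∣U′∣ − ∣U∣) h, without subtraction.
  weight-growth : ∀ {n} (U U′ : Subset n) v {h} → U ⊆ U′ →
                  (∀ x → x ∈ U′ → x ∉ U → v x ≤ h) →
                  weight U′ v + fromℕ ∣ U ∣ * h ≤ weight U v + fromℕ ∣ U′ ∣ * h
  weight-growth [] [] v U⊆U′ v≤h = ≤-refl
  weight-growth (inside ∷ U) (outside ∷ U′) v U⊆U′ v≤h with () ← U⊆U′ here
  weight-growth (outside ∷ U) (outside ∷ U′) v U⊆U′ v≤h =
    weight-growth U U′ (v ∘ suc) (drop-∷-⊆ U⊆U′)
      (λ x x∈U′ x∉U → v≤h (suc x) (there x∈U′) (λ x∈U → x∉U (drop-there x∈U)))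
  weight-growth (outside ∷ U) (inside ∷ U′) v {h} U⊆U′ v≤h = begin
    v zero + weight U′ v′ + fromℕ ∣ U ∣ * h     ≈⟨ +-assoc _ _ _ ⟩
    v zero + (weight U′ v′ + fromℕ ∣ U ∣ * h)   ≤⟨ +-mono-≤ (v≤h zero here λ ()) (weight-growth U U′ v′
      (drop-∷-⊆ U⊆U′) (λ x x∈U′ x∉U → v≤h (suc x) (there x∈U′) (λ x∈U → x∉U (drop-there x∈U)))) ⟩
    h + (weight U v′ + fromℕ ∣ U′ ∣ * h)        ≈⟨ +-congʳ (*-identityˡ h) ⟨
    1# * h + (weight U v′ + fromℕ ∣ U′ ∣ * h)   ≈⟨ solve 4 (λ o h w c →
      o :* h :+ (w :+ c :* h) := w :+ (o :+ c) :* h) refl 1# h (weight U v′) (fromℕ ∣ U′ ∣) ⟩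
    weight U v′ + (1# + fromℕ ∣ U′ ∣) * h       ∎
    where v′ = v ∘ suc
  weight-growth (inside ∷ U) (inside ∷ U′) v {h} U⊆U′ v≤h = begin
    a + weight U′ v′ + (1# + fromℕ ∣ U ∣) * h          ≈⟨ regroup a (weight U′ v′) 1# (fromℕ ∣ U ∣) h ⟩
    a + 1# * h + (weight U′ v′ + fromℕ ∣ U ∣ * h)      ≤⟨ +-monoʳ-≤ _ (weight-growth U U′ v′
      (drop-∷-⊆ U⊆U′) (λ x x∈U′ x∉U → v≤h (suc x) (there x∈U′) (λ x∈U → x∉U (drop-there x∈U)))) ⟩
    a + 1# * h + (weight U v′ + fromℕ ∣ U′ ∣ * h)      ≈⟨ regroup a (weight U v′) 1# (fromℕ ∣ U′ ∣) h ⟨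
    a + weight U v′ + (1# + fromℕ ∣ U′ ∣) * h          ∎
    where
    v′ = v ∘ suc
    a  = v zero
    regroup : ∀ a w o c h → a + w + (o + c) * h ≈ a + o * h + (w + c * h)
    regroup = solve 5 (λ a w o c h → a :+ w :+ (o :+ c) :* h := a :+ o :* h :+ (w :+ c :* h)) refl

  -- The running minimum of `G`, which is nonincreasing in `k` even where `G` is not. Newly entering
  -- items are bounded by it through its universal property.
  greatest-lower-bound : ∀ (G : ℕ → Carrier) k → ∃ λ h →
    (∀ j → j ℕ.≤ k → h ≤ G j) × (∀ x → (∀ j → j ℕ.≤ k → x ≤ G j) → x ≤ h)
  greatest-lower-bound G zero = G 0 , (λ { _ ℕ.z≤n → ≤-refl }) , λ x x≤G → x≤G 0 ℕ.z≤n
  greatest-lower-bound G (suc k) with greatest-lower-bound G k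
  ... | h , h≤G , greatest with ≤-total h (G (suc k))
  ...   | inj₁ h≤G₁₊ₖ = h , below , λ x x≤G → greatest x (λ j j≤k → x≤G j (ℕ.m≤n⇒m≤1+n j≤k))
    where
    below : ∀ j → j ℕ.≤ suc k → h ≤ G j
    below j j≤1+k with ℕ.m≤n⇒m<n∨m≡n j≤1+k
    ... | inj₁ (ℕ.s≤s j≤k) = h≤G j j≤k
    ... | inj₂ ≡.refl      = h≤G₁₊ₖ
  ...   | inj₂ G₁₊ₖ≤h = G (suc k) , below , λ x x≤G → x≤G (suc k) ℕ.≤-refl
    where
    below : ∀ j → j ℕ.≤ suc k → G (suc k) ≤ G j
    below j j≤1+k with ℕ.m≤n⇒m<n∨m≡n j≤1+k
    ... | inj₁ (ℕ.s≤s j≤k) = ≤-trans G₁₊ₖ≤h (h≤G j j≤k)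
    ... | inj₂ ≡.refl      = ≤-refl

  -- The greedy condition compares only with a value shown to be the maximum of the feasible
  -- benefits; finiteness of the item set supplies one.
  argmax : ∀ {n} (P : Pred (Fin n) 0ℓ) (w : Fin n → Carrier) → ∃ P →
           ∃ λ m → P m × (∀ x → P x → w x ≤ w m)
  argmax {suc n} P w ∃P with em {P = P zero} | em {P = ∃ (P ∘ suc)}
  ... | no ¬p₀ | no ¬p₊ = ⊥-elim (absurd ∃P)
    where
    absurd : ¬ ∃ P
    absurd (zero  , p) = ¬p₀ p
    absurd (suc x , p) = ¬p₊ (x , p)
  ... | yes p₀ | no ¬p₊ = zero , p₀ , λ { zero _ → ≤-refl ; (suc x) p → ⊥-elim (¬p₊ (x , p)) }
  ... | no ¬p₀ | yes ∃P₊ with argmax (P ∘ suc) (w ∘ suc) ∃P₊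
  ...   | m , pm , max = suc m , pm , λ { zero p → ⊥-elim (¬p₀ p) ; (suc x) p → max x p }
  argmax {suc n} P w ∃P | yes p₀ | yes ∃P₊ with argmax (P ∘ suc) (w ∘ suc) ∃P₊
  ... | m , pm , max with ≤-total (w zero) (w (suc m))
  ...   | inj₁ w₀≤ = suc m , pm , λ { zero _ → w₀≤ ; (suc x) p → max x p }
  ...   | inj₂ ≤w₀ = zero , p₀ , λ { zero _ → ≤-refl ; (suc x) p → ≤-trans (max x p) ≤w₀ }

  -- An item that enters U at step k + 1 weighs at most the least of G 0, …, G k;
  -- h stands for any such lower bound, and the slack (p k − ∣U k∣) h makes the
  -- induction go through.
  charging : ∀ {n} (U : ℕ → Subset n) (v : Fin n → Carrier) (G : ℕ → Carrier) p →
             (∀ k → ∣ U k ∣ ℕ.≤ p ℕ.* k) → (∀ k → U k ⊆ U (suc k)) →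
             (∀ k x → x ∈ U (suc k) → x ∉ U k → ∀ j → j ℕ.≤ k → v x ≤ G j) →
             ∀ k h → (∀ j → j ℕ.< k → h ≤ G j) →
             weight (U k) v + fromℕ (p ℕ.* k) * h ≤ fromℕ p * sumTo G k + fromℕ ∣ U k ∣ * h
  charging {n} U v G p ∣U∣≤ U↑ v≤G zero h h≤G = begin
    weight (U 0) v + fromℕ (p ℕ.* 0) * h     ≡⟨ ≡.cong₂ (λ V m → weight V v + fromℕ m * h) U₀≡⊥ (ℕ.*-zeroʳ p) ⟩
    weight (⊥ {n}) v + 0# * h                ≡⟨ ≡.cong (_+ 0# * h) (weight-⊥ n v) ⟩
    0# + 0# * h                              ≈⟨ +-cong (sym (zeroʳ (fromℕ p))) refl ⟩
    fromℕ p * 0# + 0# * h                    ≡⟨ ≡.cong (λ m → fromℕ p * 0# + fromℕ m * h) (≡.sym ∣U₀∣≡0) ⟩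
    fromℕ p * 0# + fromℕ ∣ U 0 ∣ * h         ∎
    where
    -- The size bound at step 0 is what forces `U 0` to be empty.
    ∣U₀∣≡0 : ∣ U 0 ∣ ≡ 0
    ∣U₀∣≡0 = ℕ.n≤0⇒n≡0 (≡.subst (∣ U 0 ∣ ℕ.≤_) (ℕ.*-zeroʳ p) (∣U∣≤ 0))
    U₀≡⊥ : U 0 ≡ ⊥
    U₀≡⊥ = Empty-unique λ { (x , x∈U₀) → ℕ.n≮0 (≡.subst (0 ℕ.<_) ∣U₀∣≡0 (∈⇒0<∣∣ x∈U₀)) }
      where
      ∈⇒0<∣∣ : ∀ {m} {x} {V : Subset m} → x ∈ V → 0 ℕ.< ∣ V ∣
      ∈⇒0<∣∣ here                      = ℕ.z<s
      ∈⇒0<∣∣ (there {y = inside} x∈V)  = ℕ.z<s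
      ∈⇒0<∣∣ (there {y = outside} x∈V) = ∈⇒0<∣∣ x∈V
  charging U v G p ∣U∣≤ U↑ v≤G (suc k) h h≤G with greatest-lower-bound G k
  ... | h′ , h′≤G , greatest = begin
    A′ + fromℕ (p ℕ.* suc k) * h ≈⟨ +-congˡ (*-congʳ split′) ⟩
    A′ + (u′ + d) * h            ≈⟨ solve 4 (λ a u d h → a :+ (u :+ d) :* h := a :+ d :* h :+ u :* h) refl A′ u′ d h ⟩
    -- `h′` is the largest admissible value of `h`, and `main` settles that case; as the slack `d`
    -- is nonnegative, `h′` may be lowered to `h`.
    A′ + d * h + u′ * h          ≤⟨ +-monoˡ-≤ (u′ * h) (≤-trans
      (+-monoʳ-≤ A′ (*-monoˡ-≤ (0≤fromℕ r) (greatest h (λ j j≤k → h≤G j (ℕ.s≤s j≤k)))))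
      (+-cancelʳ-≤ (u * h′ + u′ * h′) main)) ⟩
    P * (Σ + G k) + u′ * h       ∎
    where
    A = weight (U k) v ; A′ = weight (U (suc k)) v ; Σ = sumTo G k
    u = fromℕ ∣ U k ∣ ; u′ = fromℕ ∣ U (suc k) ∣ ; P = fromℕ p ; q = fromℕ (p ℕ.* k)
    r = p ℕ.* suc k ℕ.∸ ∣ U (suc k) ∣ ; d = fromℕ r
    split′ : fromℕ (p ℕ.* suc k) ≈ u′ + d
    split′ = trans (reflexive (≡.cong fromℕ (≡.sym (ℕ.m+[n∸m]≡n (∣U∣≤ (suc k)))))) (fromℕ-+ ∣ U (suc k) ∣ r)
    u′+d≈P+q : u′ + d ≈ P + q
    u′+d≈P+q = trans (sym split′) (trans (reflexive (≡.cong fromℕ (ℕ.*-suc p k))) (fromℕ-+ p (p ℕ.* k)))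
    -- The summand common to both sides lets the growth bound and the induction hypothesis be added
    -- without subtraction.
    main : A′ + d * h′ + (u * h′ + u′ * h′) ≤ P * (Σ + G k) + (u * h′ + u′ * h′)
    main = begin
      A′ + d * h′ + (u * h′ + u′ * h′)        ≈⟨ solve 5 (λ a d h u w → a :+ d :* h :+ (u :* h :+ w :* h) :=
        a :+ u :* h :+ (w :+ d) :* h) refl A′ d h′ u u′ ⟩
      A′ + u * h′ + (u′ + d) * h′             ≤⟨ +-mono-≤
        (weight-growth (U k) (U (suc k)) v (U↑ k) (λ x x∈ x∉ → greatest (v x) (v≤G k x x∈ x∉)))
        (≤-reflexive (*-congʳ u′+d≈P+q)) ⟩
      A + u′ * h′ + (P + q) * h′              ≈⟨ solve 5 (λ a w h P q → a :+ w :* h :+ (P :+ q) :* h :=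
        (a :+ q :* h) :+ (w :* h :+ P :* h)) refl A u′ h′ P q ⟩
      -- The step raises the capacity by `p`; these `p` units at price `h′` are paid for by the new
      -- term `P * G k`.
      (A + q * h′) + (u′ * h′ + P * h′)       ≤⟨ +-mono-≤
        (charging U v G p ∣U∣≤ U↑ v≤G k h′ (λ j j<k → h′≤G j (ℕ.<⇒≤ j<k)))
        (+-monoʳ-≤ _ (*-monoˡ-≤ (0≤fromℕ p) (h′≤G k ℕ.≤-refl))) ⟩
      (P * Σ + u * h′) + (u′ * h′ + P * G k)  ≈⟨ solve 6 (λ P s u h w g →
        (P :* s :+ u :* h) :+ (w :* h :+ P :* g) := P :* (s :+ g) :+ (u :* h :+ w :* h)) refl P Σ u h′ u′ (G k) ⟩
      P * (Σ + G k) + (u * h′ + u′ * h′)      ∎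

  total-charge : ∀ {n} (U : ℕ → Subset n) (v : Fin n → Carrier) (G : ℕ → Carrier) p →
                 (∀ k → ∣ U k ∣ ℕ.≤ p ℕ.* k) → (∀ k → U k ⊆ U (suc k)) →
                 (∀ k x → x ∈ U (suc k) → x ∉ U k → ∀ j → j ℕ.≤ k → v x ≤ G j) →
                 (∀ j → 0# ≤ G j) → ∀ k → weight (U k) v ≤ fromℕ p * sumTo G k
  total-charge U v G p ∣U∣≤ U↑ v≤G 0≤G k = begin
    weight (U k) v                              ≈⟨ x+y0≈x _ _ ⟨
    weight (U k) v + fromℕ (p ℕ.* k) * 0#       ≤⟨ charging U v G p ∣U∣≤ U↑ v≤G k 0# (λ j _ → 0≤G j) ⟩
    fromℕ p * sumTo G k + fromℕ ∣ U k ∣ * 0#    ≈⟨ x+y0≈x _ _ ⟩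
    fromℕ p * sumTo G k                         ∎
    where
    x+y0≈x : ∀ x y → x + y * 0# ≈ x
    x+y0≈x x y = trans (+-congˡ (zeroʳ y)) (+-identityʳ x)

-- Runs of policies and what they observe

[]≔inside≡∪ : ∀ {n} (p : Subset n) x → p [ x ]≔ inside ≡ p ∪ ⁅ x ⁆
[]≔inside≡∪ (inside  ∷ p) zero    = ≡.cong (inside ∷_) (≡.sym (∪-identityʳ p))
[]≔inside≡∪ (outside ∷ p) zero    = ≡.cong (inside ∷_) (≡.sym (∪-identityʳ p))
[]≔inside≡∪ (inside  ∷ p) (suc x) = ≡.cong (inside ∷_) ([]≔inside≡∪ p x)
[]≔inside≡∪ (outside ∷ p) (suc x) = ≡.cong (outside ∷_) ([]≔inside≡∪ p x)

include : ∀ {n} → Subset n → Maybe (Fin n) → Subset n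
include S = maybe′ (λ e → S ∪ ⁅ e ⁆) S

include-∪ : ∀ {n} (S T : Subset n) m → include (S ∪ T) m ≡ S ∪ include T m
include-∪ S T (just e) = ∪-assoc S T ⁅ e ⁆
include-∪ S T nothing  = ≡.refl

⊆-include : ∀ {n} (S : Subset n) m → S ⊆ include S m
⊆-include S (just e) = p⊆p∪q ⁅ e ⁆
⊆-include S nothing  = id

∣include∣≤ : ∀ {n} (S : Subset n) m → ∣ include S m ∣ ℕ.≤ suc ∣ S ∣
∣include∣≤ S (just e) = ∣p∪⁅x⁆∣≤1+∣p∣ S e
∣include∣≤ S nothing  = ℕ.n≤1+n ∣ S ∣

module Runs (em : ExcludedMiddle 0ℓ) (ℝ : CompleteOrderedField) (n : ℕ) (O : Set) where

  open Adaptive em ℝ n O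

  -- Every partial realization consistent with `Φ` is of this form, with its own domain as the set.
  -- Along a fixed `Φ`, extension of partial realizations thus becomes inclusion of sets.
  reveal : ∀ {m} → Subset m → Vec O m → Vec (Maybe O) m
  reveal = zipWith (λ b o → if b then just o else nothing)

  dom-reveal : ∀ {m} (S : Subset m) Φ → Vec.map is-just (reveal S Φ) ≡ S
  dom-reveal []            []      = ≡.refl
  dom-reveal (inside  ∷ S) (o ∷ Φ) = ≡.cong (inside ∷_) (dom-reveal S Φ)
  dom-reveal (outside ∷ S) (o ∷ Φ) = ≡.cong (outside ∷_) (dom-reveal S Φ)

  reveal-just : ∀ {m} (S : Subset m) Φ {e} → e ∈ S → lookup (reveal S Φ) e ≡ just (lookup Φ e)
  reveal-just (inside ∷ S) (o ∷ Φ) here        = ≡.refl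
  reveal-just (b ∷ S)      (o ∷ Φ) (there e∈S) = reveal-just S Φ e∈S

  reveal-just⁻ : ∀ {m} (S : Subset m) Φ e {o} → lookup (reveal S Φ) e ≡ just o → e ∈ S × lookup Φ e ≡ o
  reveal-just⁻ (inside ∷ S) (o ∷ Φ) zero    ≡.refl = here , ≡.refl
  reveal-just⁻ (b ∷ S)      (o ∷ Φ) (suc e) eq     with reveal-just⁻ S Φ e eq
  ... | e∈S , eq′ = there e∈S , eq′

  reveal-cong : ∀ {m} (S : Subset m) {Φ Φ′} → (∀ {e} → e ∈ S → lookup Φ′ e ≡ lookup Φ e) →
                reveal S Φ′ ≡ reveal S Φ
  reveal-cong []            {[]}    {[]}    agree = ≡.refl
  reveal-cong (inside  ∷ S) {_ ∷ _} {_ ∷ _} agree =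
    ≡.cong₂ (λ o Ψ → just o ∷ Ψ) (agree here) (reveal-cong S (agree ∘ there))
  reveal-cong (outside ∷ S) {_ ∷ _} {_ ∷ _} agree =
    ≡.cong (nothing ∷_) (reveal-cong S (agree ∘ there))

  consistent⇒≡reveal : ∀ {m} (Φ : Vec O m) (Ψ : Vec (Maybe O) m) →
                       (∀ e o → lookup Ψ e ≡ just o → lookup Φ e ≡ o) →
                       Ψ ≡ reveal (Vec.map is-just Ψ) Φ
  consistent⇒≡reveal []      []            Φ∼Ψ = ≡.refl
  consistent⇒≡reveal (o ∷ Φ) (just o′ ∷ Ψ) Φ∼Ψ =
    ≡.cong₂ (λ o Ψ → just o ∷ Ψ) (≡.sym (Φ∼Ψ zero o′ ≡.refl)) (consistent⇒≡reveal Φ Ψ (Φ∼Ψ ∘ suc))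
  consistent⇒≡reveal (o ∷ Φ) (nothing ∷ Ψ) Φ∼Ψ =
    ≡.cong (nothing ∷_) (consistent⇒≡reveal Φ Ψ (Φ∼Ψ ∘ suc))

  ∼-reveal : ∀ S Φ → Φ ∼ reveal S Φ
  ∼-reveal S Φ e o eq = proj₂ (reveal-just⁻ S Φ e eq)

  reveal-⊑ : ∀ {S T} Φ → S ⊆ T → reveal S Φ ⊑ reveal T Φ
  reveal-⊑ {S} {T} Φ S⊆T e o eq with reveal-just⁻ S Φ e eq
  ... | e∈S , ≡.refl = reveal-just T Φ (S⊆T e∈S)

  Agree : Subset n → Realization → Realization → Set
  Agree S Φ Φ′ = ∀ {e} → e ∈ S → lookup Φ′ e ≡ lookup Φ e

  ∼-reveal⇒Agree : ∀ S Φ Φ′ → Φ′ ∼ reveal S Φ → Agree S Φ Φ′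
  ∼-reveal⇒Agree S Φ Φ′ Φ′∼ {e} e∈S = Φ′∼ e _ (reveal-just S Φ e∈S)

  items : Policy → ℕ → Realization → Subset n
  items π k Φ = dom (run π Φ k)

  choice : Policy → ℕ → Realization → Maybe Item
  choice π k Φ = select π (run π Φ k)

  items-zero : ∀ π Φ → items π 0 Φ ≡ ⊥
  items-zero π Φ = map-replicate is-just nothing n

  items-suc : ∀ π k Φ → items π (suc k) Φ ≡ include (items π k Φ) (choice π k Φ)
  items-suc π k Φ with select π (run π Φ k)
  ... | just e  = ≡.trans (map-[]≔ is-just (run π Φ k) e) ([]≔inside≡∪ (dom (run π Φ k)) e)
  ... | nothing = ≡.refl

  items-↑ : ∀ π k Φ → items π k Φ ⊆ items π (suc k) Φ
  items-↑ π k Φ e∈ = ≡.subst (_ ∈_) (≡.sym (items-suc π k Φ)) (⊆-include _ (choice π k Φ) e∈)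

  items-mono : ∀ π {j k} → j ℕ.≤ k → ∀ Φ → items π j Φ ⊆ items π k Φ
  items-mono π {j} {k} j≤k Φ with ℕ.m≤n⇒m<n∨m≡n j≤k
  ... | inj₂ ≡.refl = id
  items-mono π {j} {suc k} _ Φ | inj₁ (ℕ.s≤s j≤k) = items-↑ π k Φ ∘ items-mono π j≤k Φ

  ∣items∣≤ : ∀ π k Φ → ∣ items π k Φ ∣ ℕ.≤ k
  ∣items∣≤ π zero    Φ rewrite items-zero π Φ = ℕ.≤-reflexive (∣⊥∣≡0 n)
  ∣items∣≤ π (suc k) Φ rewrite items-suc π k Φ =
    ℕ.≤-trans (∣include∣≤ _ (choice π k Φ)) (ℕ.s≤s (∣items∣≤ π k Φ))

  run-consistent : ∀ π Φ k → Φ ∼ run π Φ k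
  run-consistent π Φ zero e o eq with () ← ≡.trans (≡.sym (lookup-replicate e nothing)) eq
  run-consistent π Φ (suc k) e o eq with select π (run π Φ k)
  ... | nothing = run-consistent π Φ k e o eq
  ... | just e′ with e Fin.≟ e′
  ...   | yes ≡.refl = just-injective (≡.trans (≡.sym (lookup∘update e (run π Φ k) _)) eq)
  ...   | no  e≢e′   = run-consistent π Φ k e o
    (≡.trans (≡.sym (lookup∘update′ e≢e′ (run π Φ k) _)) eq)

  run≡reveal : ∀ π Φ k → run π Φ k ≡ reveal (items π k Φ) Φ
  run≡reveal π Φ k = consistent⇒≡reveal Φ (run π Φ k) (run-consistent π Φ k)

  -- A policy sees only the states of the items it selects: earlier selections are among the later
  -- ones, so equal histories give the same next choice, whose state agrees as well.
  run-cong : ∀ π k Φ Φ′ → Agree (items π k Φ) Φ Φ′ → run π Φ′ k ≡ run π Φ k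
  run-cong π zero    Φ Φ′ agree = ≡.refl
  run-cong π (suc k) Φ Φ′ agree
    rewrite run-cong π k Φ Φ′ (agree ∘ items-↑ π k Φ)
    with select π (run π Φ k) | items-suc π k Φ
  ... | nothing | _  = ≡.refl
  ... | just e  | eq = ≡.cong (λ o → run π Φ k [ e ]≔ just o)
    (agree (≡.subst (e ∈_) (≡.sym eq) (q⊆p∪q (items π k Φ) ⁅ e ⁆ (x∈⁅x⁆ e))))

  -- The set-valued analogue of a stopping time: the states on `C Φ` already determine `C Φ`. This
  -- makes the observations revealed by `C` partition the realizations.
  Stopping : (Realization → Subset n) → Set
  Stopping C = ∀ Φ Φ′ → Agree (C Φ) Φ Φ′ → C Φ′ ≡ C Φ

  items-stopping : ∀ π k → Stopping (items π k)
  items-stopping π k Φ Φ′ agree = ≡.cong dom (run-cong π k Φ Φ′ agree)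

-- Expected utility as accumulated conditional benefit

module Expectations (em : ExcludedMiddle 0ℓ) (ℝ : CompleteOrderedField) (n : ℕ) (O : Set) where

  open CompleteOrderedField ℝ hiding (zero)
  open Adaptive em ℝ n O

  module OfUtility
    (D : Distribution) (f : Utility)
    (0≤f : ∀ S Φ → 0# ≤ f S Φ) (finite : FiniteExpectations D f)
    (monotone : AdaptiveMonotone D f) (submodular : AdaptiveSubmodular D f)
    where

    open Runs em ℝ n O
    open OrderedField em ℝ
    open SumProperties em ℝ
    open Summation em ℝ
    open Charging em ℝ
    open Distribution D
    open ≤-Reasoning

    -- Termination counts as a step without gain, so every run can be summed over the same number
    -- `n` of steps.
    Gain : Maybe Item → PartialRealization → Carrier
    Gain m Ψ = maybe′ (λ e → Δ D f e Ψ) 0# m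

    utility : (Realization → Subset n) → Realization → Carrier
    utility A Φ = mass Φ * f (A Φ) Φ

    0≤utility : ∀ A Φ → 0# ≤ utility A Φ
    0≤utility A Φ = *-nonneg (nonneg Φ) (0≤f (A Φ) Φ)

    -- The bound is the sum of the family over all subsets, built by splitting on the first item. It
    -- dominates the utility of a set that varies with the realization, while finiteness is assumed
    -- for fixed sets.
    subset-family-bound : ∀ {m} (g : Subset m → Realization → Carrier) →
                          (∀ S Φ → 0# ≤ g S Φ) → (∀ S → Summable (g S)) →
                          ∃ λ v → Summable v × (∀ S Φ → g S Φ ≤ v Φ)
    subset-family-bound {zero}  g 0≤g g↓ = g [] , g↓ [] , λ { [] Φ → ≤-refl }
    subset-family-bound {suc m} g 0≤g g↓
      with subset-family-bound (g ∘ (inside ∷_))  (0≤g ∘ (inside ∷_))  (g↓ ∘ (inside ∷_))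
         | subset-family-bound (g ∘ (outside ∷_)) (0≤g ∘ (outside ∷_)) (g↓ ∘ (outside ∷_))
    ... | v , (_ , vs) , g≤v | w , (_ , ws) , g≤w = (λ Φ → v Φ + w Φ) , (_ , HasSum-+ vs ws) , bound
      where
      bound : ∀ S Φ → g S Φ ≤ v Φ + w Φ
      bound (inside  ∷ S) Φ = ≤-trans (g≤v S Φ) (x≤x+y _ (≤-trans (0≤g (outside ∷ S) Φ) (g≤w S Φ)))
      bound (outside ∷ S) Φ = ≤-trans (g≤w S Φ)
        (≤-trans (x≤x+y _ (≤-trans (0≤g (inside ∷ S) Φ) (g≤v S Φ))) (≤-reflexive (+-comm _ _)))

    utility-summable : ∀ A → Summable (utility A)
    utility-summable A with subset-family-bound (λ S → utility (λ _ → S)) (λ S → 0≤utility (λ _ → S)) finite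
    ... | v , (_ , vs) , utility≤v = dominated (0≤utility A) (λ Φ → utility≤v (A Φ) Φ) vs

    value : (Realization → Subset n) → Carrier
    value A = ∑ (utility A)

    HasSum-value : ∀ A → HasSum (utility A) (value A)
    HasSum-value A = HasSum-∑ (utility-summable A)

    value-cong : ∀ {A B} → (∀ Φ → A Φ ≡ B Φ) → value A ≈ value B
    value-cong {A} {B} A≗B = HasSum-unique
      (HasSum-cong (λ Φ → reflexive (≡.cong (λ S → mass Φ * f S Φ) (A≗B Φ))) refl (HasSum-value A))
      (HasSum-value B)

    0≤value : ∀ A → 0# ≤ value A
    0≤value A = finiteSum≤HasSum (0≤utility A) (HasSum-value A) [] []

    module _ (Ψ : PartialRealization) where

      on : Realization → Carrier
      on Φ = 𝟙 D (_∼ Ψ) Φ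

      0≤on : ∀ Φ → 0# ≤ on Φ
      0≤on Φ = 0≤indicator (Φ ∼ Ψ)

      0≤mass*on : ∀ Φ → 0# ≤ mass Φ * on Φ
      0≤mass*on Φ = *-nonneg (nonneg Φ) (0≤on Φ)

      HasSum-ℙ : HasSum (λ Φ → mass Φ * on Φ) (ℙ D (_∼ Ψ))
      HasSum-ℙ = HasSum-∑ (dominated 0≤mass*on
        (λ Φ → ≤-trans (≤-reflexive (*-comm _ _)) (indicator-*-≤ (Φ ∼ Ψ) (nonneg Φ))) total)

      mass*on≤ℙ : ∀ Φ → mass Φ * on Φ ≤ ℙ D (_∼ Ψ)
      mass*on≤ℙ Φ = ≤-trans (≤-reflexive (sym (+-identityʳ _)))
        (finiteSum≤HasSum 0≤mass*on HasSum-ℙ (Φ ∷ []) (All.[] ∷ []))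

      mass≤ℙ : ∀ {Φ} → Φ ∼ Ψ → mass Φ ≤ ℙ D (_∼ Ψ)
      mass≤ℙ {Φ} Φ∼Ψ = begin
        mass Φ        ≈⟨ *-identityʳ (mass Φ) ⟨
        mass Φ * 1#   ≡⟨ ≡.cong (mass Φ *_) (indicator-yes Φ∼Ψ) ⟨
        mass Φ * on Φ ≤⟨ mass*on≤ℙ Φ ⟩
        ℙ D (_∼ Ψ)    ∎

      -- Discreteness at work: one atom consistent with `Ψ` already gives `Ψ` positive probability.
      positive : ∀ {Φ} → 0# < mass Φ → Φ ∼ Ψ → 0# < ℙ D (_∼ Ψ)
      positive {Φ} 0<mass Φ∼Ψ = begin-strict
        0#         <⟨ 0<mass ⟩
        mass Φ     ≤⟨ mass≤ℙ Φ∼Ψ ⟩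
        ℙ D (_∼ Ψ) ∎

      -- The definition of `Δ` with the denominator cleared and the subtracted term moved across, so
      -- that both sides are sums of families over the event `_∼ Ψ`.
      HasSum-conditional : ∀ e {s t} →
        HasSum (λ Φ → on Φ * (mass Φ * f (dom Ψ) Φ)) s →
        HasSum (λ Φ → on Φ * (mass Φ * f (dom Ψ ∪ ⁅ e ⁆) Φ)) t →
        HasSum (λ Φ → Δ D f e Ψ * (mass Φ * on Φ) + on Φ * (mass Φ * f (dom Ψ) Φ)) t
      HasSum-conditional e {s} {t} us vt with em {P = 0# ≈ ℙ D (_∼ Ψ)}
      ... | no 0≉ℙ = HasSum-cong (λ _ → refl) total-gain
        (HasSum-+ (HasSum-*ˡ (monotone Ψ 0<ℙ e) 0≤mass*on HasSum-ℙ) us)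
        where
        0<ℙ : 0# < ℙ D (_∼ Ψ)
        0<ℙ = finiteSum≤HasSum 0≤mass*on HasSum-ℙ [] [] , 0≉ℙ
        difference : HasSum (λ Φ → mass Φ * (on Φ * (f (dom Ψ ∪ ⁅ e ⁆) Φ - f (dom Ψ) Φ))) (t - s)
        difference = HasSum-cong (λ Φ → sym (begin-equality
          mass Φ * (on Φ * (f (dom Ψ ∪ ⁅ e ⁆) Φ - f (dom Ψ) Φ))
            ≈⟨ solve 4 (λ m i a b → m :* (i :* (a :+ b)) := i :* (m :* a) :+ i :* (m :* b)) refl
                 (mass Φ) (on Φ) (f (dom Ψ ∪ ⁅ e ⁆) Φ) (- f (dom Ψ) Φ) ⟩
          on Φ * (mass Φ * f (dom Ψ ∪ ⁅ e ⁆) Φ) + on Φ * (mass Φ * - f (dom Ψ) Φ)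
            ≈⟨ +-congˡ (trans (*-congˡ (sym (-‿distribʳ-* _ _))) (sym (-‿distribʳ-* _ _))) ⟩
          on Φ * (mass Φ * f (dom Ψ ∪ ⁅ e ⁆) Φ) - on Φ * (mass Φ * f (dom Ψ) Φ) ∎)) refl
          (HasSum-+ vt (HasSum-neg us))
        total-gain : Δ D f e Ψ * ℙ D (_∼ Ψ) + s ≈ t
        total-gain = begin-equality
          Δ D f e Ψ * ℙ D (_∼ Ψ) + s ≈⟨ +-congʳ (trans (*-comm _ _) (z*[x/z]≈x _ 0<ℙ)) ⟩
          ∑ _ + s                    ≈⟨ +-congʳ (∑-unique difference) ⟩
          t - s + s                  ≈⟨ x-y+y≈x t s ⟩
          t                          ∎
      -- Here the quotient divides by zero, but `mass Φ * on Φ` vanishes for every `Φ`, so both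
      -- families are zero.
      ... | yes 0≈ℙ = HasSum-cong (λ Φ → sym (begin-equality
          Δ D f e Ψ * (mass Φ * on Φ) + on Φ * (mass Φ * f (dom Ψ) Φ)
            ≈⟨ +-cong (*-congˡ (null Φ)) (vanish Φ (f (dom Ψ) Φ)) ⟩
          Δ D f e Ψ * 0# + 0#                     ≈⟨ trans (+-identityʳ _) (zeroʳ _) ⟩
          0#                                      ≈⟨ vanish Φ (f (dom Ψ ∪ ⁅ e ⁆) Φ) ⟨
          on Φ * (mass Φ * f (dom Ψ ∪ ⁅ e ⁆) Φ)   ∎)) refl vt
        where
        null : ∀ Φ → mass Φ * on Φ ≈ 0#
        null Φ = ≤-antisym (≤-trans (mass*on≤ℙ Φ) (≤-reflexive (sym 0≈ℙ))) (0≤mass*on Φ)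
        vanish : ∀ Φ x → on Φ * (mass Φ * x) ≈ 0#
        vanish Φ x = begin-equality
          on Φ * (mass Φ * x) ≈⟨ solve 3 (λ i m x → i :* (m :* x) := (m :* i) :* x) refl (on Φ) (mass Φ) x ⟩
          mass Φ * on Φ * x   ≈⟨ *-congʳ (null Φ) ⟩
          0# * x              ≈⟨ zeroˡ x ⟩
          0#                  ∎

    0≤Gain : ∀ m {Ψ} → 0# < ℙ D (_∼ Ψ) → 0# ≤ Gain m Ψ
    0≤Gain (just e) 0<ℙ = monotone _ 0<ℙ e
    0≤Gain nothing  0<ℙ = ≤-refl

    -- Carries inequalities known only at positive mass to all realizations, as comparison of
    -- expectations requires.
    mass-weighted-≤ : ∀ Φ {x y} → (0# < mass Φ → x ≤ y) → mass Φ * x ≤ mass Φ * y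
    mass-weighted-≤ Φ {x} {y} x≤y with em {P = 0# ≈ mass Φ}
    ... | no 0≉mass = *-monoˡ-≤ (nonneg Φ) (x≤y (nonneg Φ , 0≉mass))
    ... | yes 0≈mass = ≤-reflexive (trans (null x) (sym (null y)))
      where
      null : ∀ z → mass Φ * z ≈ 0#
      null z = trans (*-congʳ (sym 0≈mass)) (zeroˡ z)

    module _ {A : Realization → Subset n} {m : Realization → Maybe Item}
             (A-stopping : Stopping A) (m-adapted : ∀ Φ Φ′ → Agree (A Φ) Φ Φ′ → m Φ′ ≡ m Φ) where

      private
        observed : Realization → PartialRealization
        observed Φ = reveal (A Φ) Φ

        A′ : Realization → Subset n
        A′ Φ = include (A Φ) (m Φ)

        gain : Realization → Carrier
        gain Φ = mass Φ * Gain (m Φ) (observed Φ)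

        0≤gain : ∀ Φ → 0# ≤ gain Φ
        0≤gain Φ = ≤-trans (≤-reflexive (sym (zeroʳ (mass Φ))))
          (mass-weighted-≤ Φ λ 0<mass → 0≤Gain (m Φ) (positive (observed Φ) 0<mass (∼-reveal (A Φ) Φ)))

        u : Realization → Carrier
        u Φ = gain Φ + utility A Φ

        0≤u : ∀ Φ → 0# ≤ u Φ
        0≤u Φ = +-nonneg (0≤gain Φ) (0≤utility A Φ)

        module _ (Φ₀ : Realization) where

          private
            S = A Φ₀
            Ψ = observed Φ₀

          same-A : ∀ {Φ} → Φ ∼ Ψ → A Φ ≡ S
          same-A {Φ} Φ∼Ψ = A-stopping Φ₀ Φ (∼-reveal⇒Agree S Φ₀ Φ Φ∼Ψ)

          same-m : ∀ {Φ} → Φ ∼ Ψ → m Φ ≡ m Φ₀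
          same-m {Φ} Φ∼Ψ = m-adapted Φ₀ Φ (∼-reveal⇒Agree S Φ₀ Φ Φ∼Ψ)

          class⇒∼ : ∀ {Φ} → observed Φ ≡ Ψ → Φ ∼ Ψ
          class⇒∼ {Φ} eq = ≡.subst (Φ ∼_) eq (∼-reveal (A Φ) Φ)

          -- Together with `class⇒∼` this identifies the fibres of `observed` with the events on
          -- which `Δ` conditions; the stopping property is what rules out consistent realizations
          -- that reveal a different set.
          ∼⇒class : ∀ {Φ} → Φ ∼ Ψ → observed Φ ≡ Ψ
          ∼⇒class {Φ} Φ∼Ψ = ≡.trans (≡.cong (λ T → reveal T Φ) (same-A {Φ} Φ∼Ψ))
                                    (reveal-cong S (∼-reveal⇒Agree S Φ₀ Φ Φ∼Ψ))

          localise : ∀ {g h : Realization → Carrier} → (∀ Φ → Φ ∼ Ψ → g Φ ≈ h Φ) →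
                     ∀ Φ → indicator (observed Φ ≡ Ψ) * g Φ ≈ on Ψ Φ * h Φ
          localise {g} {h} g≈h Φ with em {P = Φ ∼ Ψ}
          ... | yes Φ∼Ψ = *-cong (reflexive (indicator-yes (∼⇒class Φ∼Ψ))) (g≈h Φ Φ∼Ψ)
          ... | no  Φ≁Ψ = trans (*-congʳ (reflexive (indicator-no (Φ≁Ψ ∘ class⇒∼))))
                                (trans (zeroˡ (g Φ)) (sym (zeroˡ (h Φ))))

          restricted : ∀ T → ∃ (HasSum (λ Φ → on Ψ Φ * (mass Φ * f T Φ)))
          restricted T = dominated (λ Φ → *-nonneg (0≤on Ψ Φ) (0≤utility (λ _ → T) Φ))
            (λ Φ → indicator-*-≤ (Φ ∼ Ψ) (0≤utility (λ _ → T) Φ)) (proj₂ (finite T))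

          HasSum-A′ : ∀ {t} → HasSum (λ Φ → on Ψ Φ * (mass Φ * f (include S (m Φ₀)) Φ)) t →
                      HasSum (λ Φ → indicator (observed Φ ≡ Ψ) * utility A′ Φ) t
          HasSum-A′ = HasSum-cong (λ Φ → sym (localise (λ Φ Φ∼Ψ → reflexive
            (≡.cong₂ (λ T e → mass Φ * f (include T e) Φ)
              (same-A {Φ} Φ∼Ψ) (same-m {Φ} Φ∼Ψ))) Φ)) refl

          HasSum-u : ∀ {t} → HasSum (λ Φ → on Ψ Φ * (mass Φ * f (include S (m Φ₀)) Φ)) t →
                     HasSum (λ Φ → indicator (observed Φ ≡ Ψ) * u Φ) t
          HasSum-u {t} vt = HasSum-cong (λ Φ → sym (begin-equality
              indicator (observed Φ ≡ Ψ) * u Φ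
                ≈⟨ localise {u} {λ Φ → mass Φ * Gain (m Φ₀) Ψ + mass Φ * f S Φ} (λ Φ Φ∼Ψ → reflexive
                     (≡.cong₂ (λ x T → mass Φ * x + mass Φ * f T Φ)
                       (≡.cong₂ Gain (same-m {Φ} Φ∼Ψ) (∼⇒class Φ∼Ψ))
                       (same-A {Φ} Φ∼Ψ))) Φ ⟩
              on Ψ Φ * (mass Φ * Gain (m Φ₀) Ψ + mass Φ * f S Φ)
                ≈⟨ solve 4 (λ i m g x → i :* (m :* g :+ x) := g :* (m :* i) :+ i :* x) refl
                     (on Ψ Φ) (mass Φ) (Gain (m Φ₀) Ψ) (mass Φ * f S Φ) ⟩
              Gain (m Φ₀) Ψ * (mass Φ * on Ψ Φ) + on Ψ Φ * (mass Φ * f S Φ) ∎)) refl (expand (m Φ₀) vt)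
            where
            expand : ∀ e → HasSum (λ Φ → on Ψ Φ * (mass Φ * f (include S e) Φ)) t →
                     HasSum (λ Φ → Gain e Ψ * (mass Φ * on Ψ Φ) + on Ψ Φ * (mass Φ * f S Φ)) t
            expand nothing  vt = HasSum-cong (λ Φ → sym (trans (+-congʳ (zeroˡ _)) (+-identityˡ _))) refl vt
            expand (just e) vt = ≡.subst
              (λ T → HasSum (λ Φ → Δ D f e Ψ * (mass Φ * on Ψ Φ) + on Ψ Φ * (mass Φ * f T Φ)) t)
              (dom-reveal S Φ₀)
              (HasSum-conditional Ψ e
                (proj₂ (restricted (dom Ψ)))
                (≡.subst (λ T → HasSum (λ Φ → on Ψ Φ * (mass Φ * f (T ∪ ⁅ e ⁆) Φ)) t)
                  (≡.sym (dom-reveal S Φ₀)) vt))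

      -- On one class `A` and `m` are constant, and the identity there is `HasSum-conditional`. The
      -- classwise comparison is made in both directions: `forward` also shows that `u`, and hence
      -- the gain below it, is summable; `backward-classes` gives the reverse inequality.
      HasSum-gain : ∃ λ s → HasSum (λ Φ → mass Φ * Gain (m Φ) (reveal (A Φ) Φ)) s ×
                            s + value A ≈ value (λ Φ → include (A Φ) (m Φ))
      HasSum-gain =
        let a , u-a , a≤ = forward
            b , A′-b , b≤a = HasSum-classwise-≤ observed (0≤utility A′) 0≤u backward-classes u-a
            s , gain-s = dominated 0≤gain (λ Φ → x≤x+y (gain Φ) (0≤utility A Φ)) u-a
            a≈ = HasSum-unique u-a (HasSum-+ gain-s (HasSum-value A))
            b≈ = HasSum-unique A′-b (HasSum-value A′)
        in s , gain-s , trans (sym a≈) (≤-antisym a≤ (≤-trans (≤-reflexive (sym b≈)) b≤a))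
        where
        forward : ∃ λ a → HasSum u a × a ≤ value A′
        forward = HasSum-classwise-≤ observed 0≤u (0≤utility A′)
          (λ Φ → let t , vt = restricted Φ (include (A Φ) (m Φ)) in
                 t , t , ≤-refl , HasSum-u Φ vt , HasSum-A′ Φ vt) (HasSum-value A′)
        backward-classes : ∀ Φ₀ → ∃₂ λ s t → s ≤ t ×
          HasSum (λ Φ → indicator (observed Φ ≡ observed Φ₀) * utility A′ Φ) s ×
          HasSum (λ Φ → indicator (observed Φ ≡ observed Φ₀) * u Φ) t
        backward-classes Φ =
          let t , vt = restricted Φ (include (A Φ) (m Φ)) in
          t , t , ≤-refl , HasSum-A′ Φ vt , HasSum-u Φ vt

    -- `π` is run afresh after `C` has been observed: its choices use only its own history, but the
    -- benefit is conditioned on both observations.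
    gains : (Realization → Subset n) → Policy → Realization → ℕ → Carrier
    gains C π Φ k = Gain (choice π k Φ) (reveal (C Φ ∪ items π k Φ) Φ)

    module _ {C : Realization → Subset n} (C-stopping : Stopping C) (π : Policy) where

      -- `HasSum-gain` telescopes: `C Φ ∪ items π k Φ` is again a stopping set, and what it reveals
      -- determines the next choice of `π`.
      HasSum-gains : ∀ k → ∃ λ s → HasSum (λ Φ → mass Φ * sumTo (gains C π Φ) k) s ×
                                   s + value C ≈ value (λ Φ → C Φ ∪ items π k Φ)
      HasSum-gains zero = 0# , HasSum-0 (λ Φ → zeroʳ (mass Φ)) , trans (+-identityˡ (value C))
        (value-cong λ Φ → ≡.trans (≡.sym (∪-identityʳ (C Φ))) (≡.cong (C Φ ∪_) (≡.sym (items-zero π Φ))))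
      HasSum-gains (suc k) =
        let s , us , s≈ = HasSum-gains k
            t , vt , t≈ = HasSum-gain stopping adapted
        in
        s + t , HasSum-cong (λ Φ → sym (distribˡ (mass Φ) (sumTo (gains C π Φ) k) (gains C π Φ k))) refl (HasSum-+ us vt) , (begin-equality
          s + t + value C   ≈⟨ solve 3 (λ s t c → s :+ t :+ c := t :+ (s :+ c)) refl s t (value C) ⟩
          t + (s + value C) ≈⟨ +-congˡ s≈ ⟩
          t + value (λ Φ → C Φ ∪ items π k Φ) ≈⟨ t≈ ⟩
          value (λ Φ → include (C Φ ∪ items π k Φ) (choice π k Φ)) ≈⟨ value-cong (λ Φ →
            ≡.trans (include-∪ (C Φ) (items π k Φ) (choice π k Φ)) (≡.cong (C Φ ∪_) (≡.sym (items-suc π k Φ)))) ⟩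
          value (λ Φ → C Φ ∪ items π (suc k) Φ) ∎)
        where
        C∪ : Realization → Subset n
        C∪ Φ = C Φ ∪ items π k Φ
        agreeˡ : ∀ Φ Φ′ → Agree (C∪ Φ) Φ Φ′ → Agree (C Φ) Φ Φ′
        agreeˡ Φ Φ′ agree e∈ = agree (p⊆p∪q (items π k Φ) e∈)
        agreeʳ : ∀ Φ Φ′ → Agree (C∪ Φ) Φ Φ′ → Agree (items π k Φ) Φ Φ′
        agreeʳ Φ Φ′ agree e∈ = agree (q⊆p∪q (C Φ) (items π k Φ) e∈)
        stopping : Stopping C∪
        stopping Φ Φ′ agree = ≡.cong₂ _∪_ (C-stopping Φ Φ′ (agreeˡ Φ Φ′ agree))
                                          (items-stopping π k Φ Φ′ (agreeʳ Φ Φ′ agree))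
        adapted : ∀ Φ Φ′ → Agree (C∪ Φ) Φ Φ′ → choice π k Φ′ ≡ choice π k Φ
        adapted Φ Φ′ agree = ≡.cong (select π) (run-cong π k Φ Φ′ (agreeʳ Φ Φ′ agree))

    gains-nonneg : ∀ C π {Φ} → 0# < mass Φ → ∀ k → 0# ≤ gains C π Φ k
    gains-nonneg C π {Φ} 0<mass k = 0≤Gain (choice π k Φ)
      (positive (reveal (C Φ ∪ items π k Φ) Φ) 0<mass (∼-reveal (C Φ ∪ items π k Φ) Φ))

    sumTo-nonneg : ∀ {g} → (∀ k → 0# ≤ g k) → ∀ k → 0# ≤ sumTo g k
    sumTo-nonneg 0≤g zero    = ≤-refl
    sumTo-nonneg 0≤g (suc k) = +-nonneg (sumTo-nonneg 0≤g k) (0≤g k)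

    0≤mass*gains : ∀ C π k Φ → 0# ≤ mass Φ * sumTo (gains C π Φ) k
    0≤mass*gains C π k Φ = ≤-trans (≤-reflexive (sym (zeroʳ (mass Φ))))
      (mass-weighted-≤ Φ λ 0<mass → sumTo-nonneg (gains-nonneg C π 0<mass) k)

    -- A policy may select an observed item again. Such a step has to be free, since the weight of a
    -- set counts every item once.
    Δ-observed : ∀ {e Ψ} → e ∈ dom Ψ → Δ D f e Ψ ≈ 0#
    Δ-observed {e} {Ψ} e∈Ψ = trans (*-congʳ (∑-unique (HasSum-0 λ Φ → begin-equality
      mass Φ * (on Ψ Φ * (f (dom Ψ ∪ ⁅ e ⁆) Φ - f (dom Ψ) Φ))
        ≡⟨ ≡.cong (λ S → mass Φ * (on Ψ Φ * (f S Φ - f (dom Ψ) Φ))) (∪-absorb (⁅x⁆⊆ e∈Ψ)) ⟩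
      mass Φ * (on Ψ Φ * (f (dom Ψ) Φ - f (dom Ψ) Φ))
        ≈⟨ *-congˡ (trans (*-congˡ (-‿inverseʳ _)) (zeroʳ (on Ψ Φ))) ⟩
      mass Φ * 0#  ≈⟨ zeroʳ (mass Φ) ⟩
      0#           ∎))) (zeroˡ _)

-- The greedy run against a feasible policy

module GreedyRun (em : ExcludedMiddle 0ℓ) (ℝ : CompleteOrderedField) (n : ℕ) (O : Set) where

  open CompleteOrderedField ℝ hiding (zero)
  open Adaptive em ℝ n O

  module WithGreedy
    (D : Distribution) (f : Utility)
    (0≤f : ∀ S Φ → 0# ≤ f S Φ) (finite : FiniteExpectations D f)
    (monotone : AdaptiveMonotone D f) (submodular : AdaptiveSubmodular D f)
    {p : ℕ} {ℐ : Pred (Subset n) 0ℓ} (isIndep : IsIndependenceSystem p ℐ)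
    {α : Carrier} (0≤α : 0# ≤ α)
    {π : Policy} (isGreedy : IsApproxGreedy D f α ℐ π)
    {π* : Policy} (feasible : Feasible ℐ π*)
    where

    open Runs em ℝ n O
    open OrderedField em ℝ
    open SumProperties em ℝ
    open Classical em
    open Charging em ℝ
    open Expectations em ℝ n O
    open OfUtility D f 0≤f finite monotone submodular
    open Distribution D
    open IsIndependenceSystem isIndep
    open IsApproxGreedy isGreedy

    module _ {Φ : Realization} (0<mass : 0# < mass Φ) where

      private
        S : ℕ → Subset n
        S k = items π k Φ

        T : ℕ → Subset n
        T k = items π* k Φ

      0<ℙ-reveal : ∀ R → 0# < ℙ D (_∼ reveal R Φ)
      0<ℙ-reveal R = positive (reveal R Φ) 0<mass (∼-reveal R Φ)

      0<ℙ-run : ∀ k → 0# < ℙ D (_∼ run π Φ k)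
      0<ℙ-run k = positive (run π Φ k) 0<mass (run-consistent π Φ k)

      greedyStep : ∀ k → ∃ (Addable ℐ (run π Φ k)) →
        ∃ λ e → select π (run π Φ k) ≡ just e × Addable ℐ (run π Φ k) e ×
        (∀ m → IsMaximum _≤_ (FeasibleBenefit D f ℐ (run π Φ k)) m → α * m ≤ Δ D f e (run π Φ k))
      greedyStep k = greedy (run π Φ k) (Φ , k , ≡.refl) (0<ℙ-run k)

      S-selected : ∀ k {e} → select π (run π Φ k) ≡ just e → S (suc k) ≡ S k ∪ ⁅ e ⁆
      S-selected k eq = ≡.trans (items-suc π k Φ) (≡.cong (include (S k)) eq)

      S-stopped : ∀ k → ¬ ∃ (Addable ℐ (run π Φ k)) → S (suc k) ≡ S k
      S-stopped k none = ≡.trans (items-suc π k Φ)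
        (≡.cong (include (S k)) (stop (run π Φ k) (Φ , k , ≡.refl) (0<ℙ-run k) none))

      S-independent : ∀ k → ℐ (S k)
      S-independent zero = ≡.subst ℐ (≡.sym (items-zero π Φ)) (hereditary ⊥⊆ (proj₂ nonempty))
      S-independent (suc k) = by em
        where
        by : Dec (∃ (Addable ℐ (run π Φ k))) → ℐ (S (suc k))
        by (no none) = ≡.subst ℐ (≡.sym (S-stopped k none)) (S-independent k)
        by (yes addable) =
          let e , eq , (_ , S∪e∈ℐ) , _ = greedyStep k addable in
          ≡.subst ℐ (≡.sym (S-selected k eq)) S∪e∈ℐ

      -- Either every step so far has added a new item or nothing can be added any more. After `n`
      -- steps both alternatives exclude a further item.
      S-progress : ∀ k → k ℕ.≤ ∣ S k ∣ ⊎ ¬ ∃ (Addable ℐ (run π Φ k))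
      S-progress zero = inj₁ ℕ.z≤n
      S-progress (suc k) = by em (S-progress k)
        where
        by : Dec (∃ (Addable ℐ (run π Φ k))) → k ℕ.≤ ∣ S k ∣ ⊎ ¬ ∃ (Addable ℐ (run π Φ k)) →
             suc k ℕ.≤ ∣ S (suc k) ∣ ⊎ ¬ ∃ (Addable ℐ (run π Φ (suc k)))
        by (yes addable) (inj₂ none) = ⊥-elim (none addable)
        by (yes addable) (inj₁ k≤∣S∣) =
          let e , eq , (e∉S , _) , _ = greedyStep k addable in
          inj₁ (≡.subst (λ R → suc k ℕ.≤ ∣ R ∣) (≡.sym (S-selected k eq))
            (ℕ.≤-trans (ℕ.s≤s k≤∣S∣) (∣p∣<∣p∪⁅x⁆∣ (S k) e∉S)))
        by (no none) _ = inj₂ (≡.subst (λ Ψ → ¬ ∃ (Addable ℐ Ψ)) (≡.sym run-stopped) none)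
          where
          run-stopped : run π Φ (suc k) ≡ run π Φ k
          run-stopped = ≡.cong (maybe′ (λ e → run π Φ k [ e ]≔ just (lookup Φ e)) (run π Φ k))
            (stop (run π Φ k) (Φ , k , ≡.refl) (0<ℙ-run k) none)

      S-maximal : ¬ ∃ (Addable ℐ (run π Φ n))
      S-maximal addable@(e , e∉S , _) with S-progress n
      ... | inj₂ none = none addable
      ... | inj₁ n≤∣S∣ = ℕ.<⇒≱ (∣p∣<∣p∪⁅x⁆∣ (S n) e∉S) (ℕ.≤-trans (∣p∣≤n (S n ∪ ⁅ e ⁆)) n≤∣S∣)

      -- Chosen items count as blocked, so that at the end of the greedy run every item is blocked
      -- and each item of `T n` has been charged.
      Blocked : ℕ → Pred Item 0ℓ
      Blocked k e = e ∈ S k ⊎ ¬ ℐ (S k ∪ ⁅ e ⁆)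

      U : ℕ → Subset n
      U k = comprehension {P = λ e → e ∈ T n × Blocked k e}

      U-⊆ : ∀ k → U k ⊆ U (suc k)
      U-⊆ k e∈U with ∈-comprehension⁻ e∈U
      ... | e∈T , inj₁ e∈S    = ∈-comprehension⁺ (e∈T , inj₁ (items-↑ π k Φ e∈S))
      ... | e∈T , inj₂ S∪e∉ℐ = ∈-comprehension⁺ (e∈T , inj₂ λ S′∪e∈ℐ →
        S∪e∉ℐ (hereditary (∪-monoˡ-⊆ _ (items-↑ π k Φ)) S′∪e∈ℐ))

      U-size : ∀ k → ∣ U k ∣ ℕ.≤ p ℕ.* k
      U-size k = ℕ.≤-trans
        (independent-size-≤ isIndep {C = S k ∪ U k} S-maximal-in
          (q⊆p∪q (S k) (U k)) (hereditary (proj₁ ∘ ∈-comprehension⁻) (feasible Φ)))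
        (ℕ.*-monoʳ-≤ p (∣items∣≤ π k Φ))
        where
        S-maximal-in : MaximalIndependent ℐ (S k ∪ U k) (S k)
        S-maximal-in = p⊆p∪q (U k) , S-independent k , blocked
          where
          blocked : ∀ e → e ∈ S k ∪ U k → e ∉ S k → ¬ ℐ (S k ∪ ⁅ e ⁆)
          blocked e e∈ e∉S with x∈p∪q⁻ (S k) (U k) e∈
          ... | inj₁ e∈S = ⊥-elim (e∉S e∈S)
          ... | inj₂ e∈U with proj₂ (∈-comprehension⁻ e∈U)
          ...   | inj₁ e∈S    = ⊥-elim (e∉S e∈S)
          ...   | inj₂ S∪e∉ℐ = S∪e∉ℐ

      U-final : U n ≡ T n
      U-final = ⊆-antisym (proj₁ ∘ ∈-comprehension⁻) λ {e} e∈T → ∈-comprehension⁺ (e∈T , blocked e)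
        where
        blocked : ∀ e → Blocked n e
        blocked e with e ∈? S n
        ... | yes e∈S = inj₁ e∈S
        ... | no  e∉S = inj₂ λ S∪e∈ℐ → S-maximal (e , e∉S , S∪e∈ℐ)

      -- Conditioning on the finished run of `π` puts this value between the two uses of
      -- submodularity: it is at most the benefit at any earlier stage of `π`, and at least the
      -- benefit once `π*` has been appended.
      benefit : Item → Carrier
      benefit e = Δ D f e (reveal (S n) Φ)

      greedyGain : ℕ → Carrier
      greedyGain = gains (λ _ → ⊥) π Φ

      greedyGain≡ : ∀ k {e} → select π (run π Φ k) ≡ just e → greedyGain k ≡ Δ D f e (run π Φ k)
      greedyGain≡ k eq = ≡.cong₂ Gain eq
        (≡.trans (≡.cong (λ R → reveal R Φ) (∪-identityˡ (S k))) (≡.sym (run≡reveal π Φ k)))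

      α-benefit≤greedyGain : ∀ {j e} → j ℕ.≤ n → e ∉ S j → ℐ (S j ∪ ⁅ e ⁆) →
                             α * benefit e ≤ greedyGain j
      α-benefit≤greedyGain {j} {e} j≤n e∉S S∪e∈ℐ =
        let e′ , eq , _ , approx = greedyStep j (e , e∉S , S∪e∈ℐ)
            b , S∪b∈ℐ , b-max = argmax (λ x → ℐ (S j ∪ ⁅ x ⁆)) (λ x → Δ D f x (run π Φ j)) (e , S∪e∈ℐ)
        in begin
          α * benefit e             ≤⟨ *-monoˡ-≤ 0≤α (submodular (run π Φ j) (reveal (S n) Φ)
            (≡.subst (_⊑ reveal (S n) Φ) (≡.sym (run≡reveal π Φ j)) (reveal-⊑ Φ (items-mono π j≤n Φ)))
            (0<ℙ-reveal (S n)) e) ⟩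
          -- The detour through the maximizer `b` is forced by the form of `approx`, which accepts
          -- only a maximum.
          α * Δ D f e (run π Φ j)   ≤⟨ *-monoˡ-≤ 0≤α (b-max e S∪e∈ℐ) ⟩
          α * Δ D f b (run π Φ j)   ≤⟨ approx (Δ D f b (run π Φ j))
            ((b , S∪b∈ℐ , refl) , λ { x (c , S∪c∈ℐ , x≈) → ≤-trans (≤-reflexive x≈) (b-max c S∪c∈ℐ) }) ⟩
          Δ D f e′ (run π Φ j)      ≡⟨ greedyGain≡ j eq ⟨
          greedyGain j              ∎
        where open ≤-Reasoning

      -- An item not blocked after `k` steps was, by heredity, a candidate at every step `j` up to
      -- `k`, so each of these greedy gains bounds its weight.
      newly-blocked : ∀ k e → e ∈ U (suc k) → e ∉ U k → ∀ j → j ℕ.≤ k → α * benefit e ≤ greedyGain j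
      newly-blocked k e e∈U′ e∉U j j≤k = α-benefit≤greedyGain j≤n
        (e∉S ∘ items-mono π j≤k Φ) (hereditary (∪-monoˡ-⊆ ⁅ e ⁆ (items-mono π j≤k Φ)) S∪e∈ℐ)
        where
        unblocked : ¬ Blocked k e
        unblocked blocked = e∉U (∈-comprehension⁺ (proj₁ (∈-comprehension⁻ e∈U′) , blocked))
        e∉S : e ∉ S k
        e∉S = unblocked ∘ inj₁
        S∪e∈ℐ : ℐ (S k ∪ ⁅ e ⁆)
        S∪e∈ℐ = decidable-stable em (unblocked ∘ inj₂)
        -- Beyond step `n` no item enters: one still unblocked then would already have been addable
        -- after `n` steps.
        j≤n : j ℕ.≤ n
        j≤n with ℕ.≤-total j n
        ... | inj₁ j≤n = j≤n
        ... | inj₂ n≤j = ⊥-elim (S-maximal (e , e∉S ∘ Sₙ⊆S , hereditary (∪-monoˡ-⊆ ⁅ e ⁆ Sₙ⊆S) S∪e∈ℐ))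
          where
          Sₙ⊆S : S n ⊆ S k
          Sₙ⊆S = items-mono π (ℕ.≤-trans n≤j j≤k) Φ

      optimalGain : ℕ → Carrier
      optimalGain = gains (items π n) π* Φ

      -- A new item gains no more after `S n ∪ T k` than after `S n` alone, and a repeated one gains
      -- nothing, so each item of `π*` is paid for once at its `benefit`.
      optimalGain-step : ∀ k m → α * sumTo optimalGain k ≤ weight (T k) (λ e → α * benefit e) →
        α * (sumTo optimalGain k + Gain m (reveal (S n ∪ T k) Φ)) ≤
        weight (include (T k) m) (λ e → α * benefit e)
      optimalGain-step k nothing ih = begin
        α * (sumTo optimalGain k + 0#)      ≈⟨ *-congˡ (+-identityʳ (sumTo optimalGain k)) ⟩
        α * sumTo optimalGain k             ≤⟨ ih ⟩
        weight (T k) (λ e → α * benefit e)  ∎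
        where open ≤-Reasoning
      optimalGain-step k (just e) ih = by (e ∈? T k)
        where
        open ≤-Reasoning
        Ψ = reveal (S n ∪ T k) Φ
        v : Item → Carrier
        v e = α * benefit e
        by : Dec (e ∈ T k) → α * (sumTo optimalGain k + Δ D f e Ψ) ≤ weight (T k ∪ ⁅ e ⁆) v
        by (yes e∈T) = begin
          α * (sumTo optimalGain k + Δ D f e Ψ) ≈⟨ *-congˡ (+-congˡ (Δ-observed
            (≡.subst (e ∈_) (≡.sym (dom-reveal (S n ∪ T k) Φ)) (q⊆p∪q (S n) (T k) e∈T)))) ⟩
          α * (sumTo optimalGain k + 0#)        ≈⟨ *-congˡ (+-identityʳ (sumTo optimalGain k)) ⟩
          α * sumTo optimalGain k               ≤⟨ ih ⟩
          weight (T k) v                        ≡⟨ ≡.cong (λ R → weight R v) (∪-absorb (⁅x⁆⊆ e∈T)) ⟨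
          weight (T k ∪ ⁅ e ⁆) v                ∎
        by (no e∉T) = begin
          α * (sumTo optimalGain k + Δ D f e Ψ)   ≈⟨ distribˡ α (sumTo optimalGain k) (Δ D f e Ψ) ⟩
          α * sumTo optimalGain k + α * Δ D f e Ψ ≤⟨ +-mono-≤ ih (*-monoˡ-≤ 0≤α
            (submodular (reveal (S n) Φ) Ψ (reveal-⊑ {S n} {S n ∪ T k} Φ (p⊆p∪q (T k))) (0<ℙ-reveal (S n ∪ T k)) e)) ⟩
          weight (T k) v + v e                    ≈⟨ weight-insert (T k) v e∉T ⟨
          weight (T k ∪ ⁅ e ⁆) v                  ∎

      optimalGain≤weight : ∀ k → α * sumTo optimalGain k ≤ weight (T k) (λ e → α * benefit e)
      optimalGain≤weight zero = ≤-reflexive (trans (zeroʳ α) (reflexive (≡.sym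
        (≡.trans (≡.cong (λ R → weight R (λ e → α * benefit e)) (items-zero π* Φ))
                 (weight-⊥ n (λ e → α * benefit e))))))
      optimalGain≤weight (suc k) =
        ≡.subst (λ R → α * sumTo optimalGain (suc k) ≤ weight R (λ e → α * benefit e))
          (≡.sym (items-suc π* k Φ))
          (optimalGain-step k (choice π* k Φ) (optimalGain≤weight k))

      optimalGain≤greedyGain : α * sumTo optimalGain n ≤ fromℕ p * sumTo greedyGain n
      optimalGain≤greedyGain = begin
        α * sumTo optimalGain n             ≤⟨ optimalGain≤weight n ⟩
        weight (T n) (λ e → α * benefit e)  ≡⟨ ≡.cong (λ R → weight R (λ e → α * benefit e)) U-final ⟨
        weight (U n) (λ e → α * benefit e)  ≤⟨ total-charge U (λ e → α * benefit e) greedyGain p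
          U-size U-⊆ newly-blocked (gains-nonneg (λ _ → ⊥) π 0<mass) n ⟩
        fromℕ p * sumTo greedyGain n        ∎
        where open ≤-Reasoning

    value-bound : α * value (items π* n) ≤ (fromℕ p + α) * value (items π n)
    value-bound =
      -- `x`, `y` and `z` are the expected total gains of `π` after `π*`, of `π*` after `π`, and of
      -- `π` from nothing.
      let x , x-sum , x≈ = HasSum-gains {C = items π* n} (items-stopping π* n) π n
          y , y-sum , y≈ = HasSum-gains {C = items π n} (items-stopping π n) π* n
          z , z-sum , z≈ = HasSum-gains {C = λ _ → ⊥} (λ _ _ _ → ≡.refl) π n
          0≤x : 0# ≤ x
          0≤x = finiteSum≤HasSum (0≤mass*gains (items π* n) π n) x-sum [] []
          αy≤pz : α * y ≤ fromℕ p * z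
          αy≤pz = HasSum-mono pointwise
            (HasSum-*ˡ 0≤α (0≤mass*gains (items π n) π* n) y-sum)
            (HasSum-*ˡ (0≤fromℕ p) (0≤mass*gains (λ _ → ⊥) π n) z-sum)
      in begin
        α * value (items π* n)             ≤⟨ *-monoˡ-≤ 0≤α (x≤x+y (value (items π* n)) 0≤x) ⟩
        -- The utility depends on the selected set and not on the order of selection: the union
        -- reached by running `π` after `π*` is also reached by running `π*` after `π`.
        α * (value (items π* n) + x)       ≈⟨ *-congˡ (trans (+-comm _ x) (trans x≈ (trans
          (value-cong (λ Φ → ∪-comm (items π* n Φ) (items π n Φ))) (sym y≈)))) ⟩
        α * (y + value (items π n))        ≈⟨ distribˡ α y (value (items π n)) ⟩
        α * y + α * value (items π n)      ≤⟨ +-monoˡ-≤ (α * value (items π n)) αy≤pz ⟩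
        -- `z` is the utility of `π` in excess of that of the empty set; nonnegativity of `f` allows
        -- the latter to be added.
        fromℕ p * z + α * value (items π n) ≤⟨ +-monoˡ-≤ (α * value (items π n)) (*-monoˡ-≤ (0≤fromℕ p)
          (x≤x+y z (0≤value (λ _ → ⊥)))) ⟩
        fromℕ p * (z + value (λ _ → ⊥)) + α * value (items π n) ≈⟨ +-congʳ (*-congˡ
          (trans z≈ (value-cong (λ Φ → ∪-identityˡ (items π n Φ))))) ⟩
        fromℕ p * value (items π n) + α * value (items π n) ≈⟨ distribʳ (value (items π n)) (fromℕ p) α ⟨
        (fromℕ p + α) * value (items π n)  ∎
      where
      open ≤-Reasoning
      pointwise : ∀ Φ → α * (mass Φ * sumTo (gains (items π n) π* Φ) n) ≤
                        fromℕ p * (mass Φ * sumTo (gains (λ _ → ⊥) π Φ) n)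
      pointwise Φ = begin
        α * (mass Φ * sumTo (gains (items π n) π* Φ) n)       ≈⟨ swap α (mass Φ) _ ⟩
        mass Φ * (α * sumTo (gains (items π n) π* Φ) n)       ≤⟨ mass-weighted-≤ Φ optimalGain≤greedyGain ⟩
        mass Φ * (fromℕ p * sumTo (gains (λ _ → ⊥) π Φ) n)    ≈⟨ swap (mass Φ) (fromℕ p) _ ⟩
        fromℕ p * (mass Φ * sumTo (gains (λ _ → ⊥) π Φ) n)    ∎
        where
        swap : ∀ a b c → a * (b * c) ≈ b * (a * c)
        swap = solve 3 (λ a b c → a :* (b :* c) := b :* (a :* c)) refl

-- The approximation guarantee

theorem7 : (em : ExcludedMiddle 0ℓ) (ℝ : CompleteOrderedField) (n : ℕ) (O : Set) →
    let open CompleteOrderedField ℝ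
        open Adaptive em ℝ n O in
    (D : Distribution) (f : Utility) →
    (∀ S Φ → 0# ≤ f S Φ) →
    FiniteExpectations D f →
    AdaptiveMonotone D f →
    AdaptiveSubmodular D f →
    (p : ℕ) → .{{_ : NonZero p}} →
    (ℐ : Pred (Subset n) 0ℓ) → IsIndependenceSystem p ℐ →
    (α : Carrier) → 0# ≤ α → α ≤ 1# →
    (π : Policy) → IsApproxGreedy D f α ℐ π →
    (π* : Policy) → Feasible ℐ π* →
    α / (fromℕ p + α) * f-avg D f π* ≤ f-avg D f π
theorem7 em ℝ n O D f 0≤f finite monotone submodular p@(suc p′) ℐ isIndep α 0≤α α≤1
         π isGreedy π* feasible = begin
  α / c * f-avg D f π*   ≈⟨ solve 3 (λ a i v → a :* i :* v := a :* v :* i) refl α (c ⁻¹) (f-avg D f π*) ⟩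
  α * f-avg D f π* / c   ≤⟨ *-monoʳ-≤ (⁻¹-nonneg 0<c) value-bound ⟩
  c * f-avg D f π / c    ≈⟨ *-assoc c (f-avg D f π) (c ⁻¹) ⟩
  c * (f-avg D f π / c)  ≈⟨ z*[x/z]≈x (f-avg D f π) 0<c ⟩
  f-avg D f π            ∎
  where
  open CompleteOrderedField ℝ hiding (zero)
  open Adaptive em ℝ n O
  open OrderedField em ℝ
  open GreedyRun em ℝ n O
  open WithGreedy D f 0≤f finite monotone submodular isIndep 0≤α isGreedy feasible
  open ≤-Reasoning
  c : Carrier
  c = fromℕ p + α
  -- Positivity of `p` makes the denominator positive even when `α` is zero.
  0<c : 0# < c
  0<c = begin-strict
    0#                  <⟨ 0<1 ⟩
    1#                  ≤⟨ x≤x+y 1# (0≤fromℕ p′) ⟩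
    fromℕ p             ≤⟨ x≤x+y (fromℕ p) 0≤α ⟩
    fromℕ p + α         ∎
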